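{- Let $n,k,d$ be positive integers. (1) If there exists an integer cyclically $k$-diagonal $\mathrm{H}_k(n;k)$ with $n\geq k+4$, then there exists an integer cyclically $(k+4)$-diagonal $\mathrm{H}_{k+4}(n;k+4)$. (2) If there exists an integer cyclically $(2,d)$-diagonal $\mathrm{H}_{2d}(n;2d)$ with $n\geq 2d+4$, then there exists an integer cyclically $(2,d+2)$-diagonal $\mathrm{H}_{2d+4}(n;2d+4)$. (3) If there exists an integer cyclically $(2,d)$-diagonal $\mathrm{H}_{2d-1}(n;2d-1)$ with $n\equiv 0\pmod 4$ and $n\geq 2d+6$, then there exists an integer cyclically $(2,d+3)$-diagonal $\mathrm{H}_{2d+5}(n;2d+5)$.
   Context: A partially filled (p.f.) $m\times n$ array is an $m\times n$ matrix in which some cells are allowed to be empty. Let $n,k,t$ be positive integers such that $t$ divides $2nk$, let $v=2nk+t$, and let $J$ be the subgroup of $\mathbb{Z}_v$ of order $t$. An $\mathrm{H}_t(n;k)$ (square Heffter array over $\mathbb{Z}_v$ relative to $J$) is an $n\times n$ p.f. array with elements in $\mathbb{Z}_v$ such that: each row and each column contains exactly $k$ filled cells; for every $x\in\mathbb{Z}_v\setminus J$, either $x$ or $-x$ appears in the array; the elements in every row and every column sum to $0$ in $\mathbb{Z}_v$. It is called integer if the elements in every row and every column, viewed as integers in $\pm\{1,\ldots,\lfloor\frac{2nk+t}{2}\rfloor\}$, sum to zero in $\mathbb{Z}$. For an $n\times n$ array and $i\in\{1,\ldots,n\}$, the $i$-th diagonal is $D_i=\{(i,1),(i+1,2),\ldots,(i-1,n)\}$,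 with row and column indices taken modulo $n$ in $\{1,\ldots,n\}$; the diagonals $D_i,D_{i+1},\ldots,D_{i+k-1}$ (indices modulo $n$) are called $k$ consecutive diagonals. A square p.f. array of size $n\ge k$ is cyclically $k$-diagonal if its nonempty cells are exactly those of $k$ consecutive diagonals. A p.f. array $S$ is cyclically $(s,k)$-diagonal if it is obtained as follows: take a cyclically $k$-diagonal $N\times N$ p.f. array $A$; replace each cell of $A$ with an $s\times s$ (partially filled) array which is totally empty if the corresponding cell of $A$ is empty, obtaining an $sN\times sN$ array with columns $\overline{C}_1,\ldots,\overline{C}_{sN}$; let $S$ be any array whose ordered columns are $\overline{C}_i,\overline{C}_{i+1},\ldots,\overline{C}_{sN},\overline{C}_1,\ldots,\overline{C}_{i-1}$ for some $i\in\{1,\ldots,sN\}$. -}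

module Defs where

open import Data.Bool.Base using (if_then_else_)
open import Data.Fin.Base using (Fin; toℕ; cast; remQuot)
open import Data.Fin.Properties using (nonZeroIndex)
open import Data.Fin.Subset using (Subset; _∈_; _∉_; ∣_∣)
open import Data.Integer.Base as ℤ using (ℤ; 0ℤ)
open import Data.List.Base using (List; foldr; length; map; mapMaybe; allFin)
open import Data.Maybe.Base using (Maybe; just; nothing)
open import Data.Maybe using (Is-just)
open import Data.Nat.Base using (ℕ; NonZero; _+_; _*_; _∸_; _≤_; _<_; _≤ᵇ_; ⌊_/2⌋; >-nonZero)
open import Data.Nat.Divisibility.Core using (_∣_)
open import Data.Nat.DivMod using (_mod_)
open import Data.Nat.Properties using (≤-trans; m≤n+m)
open import Data.Product.Base using (_×_; _,_; ∃-syntax)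
open import Data.Sum.Base using (_⊎_)
open import Data.Unit.Base using (⊤)
open import Function.Bundles using (_⇔_)
open import Relation.Binary.PropositionalEquality.Core using (_≡_)

-- Partially filled arrays; `nothing` marks an empty cell.

PFArray : ℕ → ℕ → Set → Set
PFArray m n X = Fin m → Fin n → Maybe X

row : ∀ {m n X} → PFArray m n X → Fin m → List X
row {n = n} A r = mapMaybe (λ c → A r c) (allFin n)

col : ∀ {m n X} → PFArray m n X → Fin n → List X
col {m = m} A c = mapMaybe (λ r → A r c) (allFin m)

AppearsIn : ∀ {m n X} → X → PFArray m n X → Set
AppearsIn x A = ∃[ r ] ∃[ c ] A r c ≡ just x

-- Fin v represents ℤ_v by least non-negative residues.

module ℤMod (v : ℕ) .{{_ : NonZero v}} where

  0ᵥ : Fin v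
  0ᵥ = 0 mod v

  infixl 6 _+ᵥ_
  _+ᵥ_ : Fin v → Fin v → Fin v
  x +ᵥ y = (toℕ x + toℕ y) mod v

  infix 8 -ᵥ_
  -ᵥ_ : Fin v → Fin v
  -ᵥ x = (v ∸ toℕ x) mod v

  sumᵥ : List (Fin v) → Fin v
  sumᵥ = foldr _+ᵥ_ 0ᵥ

  record IsSubgroup (J : Subset v) : Set where
    field
      0∈J      : 0ᵥ ∈ J
      +-closed : ∀ {x y} → x ∈ J → y ∈ J → x +ᵥ y ∈ J
      neg-closed : ∀ {x} → x ∈ J → -ᵥ x ∈ J

-- The representative of a class of ℤ_v in ±{0, …, ⌊v/2⌋}.  The positive sign
-- chosen for v/2 (v even), and the value at 0, are immaterial for relative
-- Heffter arrays: both classes then lie in J, and no element of J occurs in the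
-- array because its nk cells already have to meet the nk pairs {x , -x} of ℤ_v ∖ J.
-- For the same reason exactly one of x and -x occurs for each x outside J.

centred : ∀ {v} → Fin v → ℤ
centred {v} x = if toℕ x ≤ᵇ ⌊ v /2⌋ then ℤ.+ toℕ x else toℕ x ℤ.⊖ v

sumℤ : List ℤ → ℤ
sumℤ = foldr ℤ._+_ 0ℤ

modulus : ℕ → ℕ → ℕ → ℕ
modulus n k t = 2 * n * k + t

-- IsHeffter n k t A says that A is an H_t(n;k).  The subgroup of order t of a
-- cyclic group is unique, so the field J is determined by the other data.

record IsHeffter (n k t : ℕ) (A : PFArray n n (Fin (modulus n k t))) : Set where
  field
    0<n   : 0 < n
    0<k   : 0 < k
    0<t   : 0 < t
    t∣2nk : t ∣ 2 * n * k

  open ℤMod (modulus n k t) {{>-nonZero (≤-trans 0<t (m≤n+m t (2 * n * k)))}}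

  field
    J          : Subset (modulus n k t)
    isSubgroup : IsSubgroup J
    order      : ∣ J ∣ ≡ t
    rowFilled  : ∀ r → length (row A r) ≡ k
    colFilled  : ∀ c → length (col A c) ≡ k
    covers     : ∀ x → x ∉ J → AppearsIn x A ⊎ AppearsIn (-ᵥ x) A
    rowSum     : ∀ r → sumᵥ (row A r) ≡ 0ᵥ
    colSum     : ∀ c → sumᵥ (col A c) ≡ 0ᵥ

record IsIntegerHeffter (n k t : ℕ) (A : PFArray n n (Fin (modulus n k t))) : Set where
  field
    isHeffter : IsHeffter n k t A
    rowSumℤ   : ∀ r → sumℤ (map centred (row A r)) ≡ 0ℤ
    colSumℤ   : ∀ c → sumℤ (map centred (col A c)) ≡ 0ℤ

-- Cyclic shift of an index; indices run over {0, …, n-1} instead of {1, …, n}.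

infixl 6 _⊕_
_⊕_ : ∀ {n} → Fin n → ℕ → Fin n
_⊕_ {n} i j = _mod_ (toℕ i + j) n {{nonZeroIndex i}}

-- D_i is the set of the cells (i + c , c).

OnDiagonal : ∀ {n} → Fin n → Fin n → Fin n → Set
OnDiagonal i r c = r ≡ i ⊕ toℕ c

CyclicallyDiagonal : ∀ {n X} → ℕ → PFArray n n X → Set
CyclicallyDiagonal {n} k A =
  k ≤ n ×
  ∃[ i ] (∀ r c → Is-just (A r c) ⇔ (∃[ j ] (j < k × OnDiagonal (i ⊕ j) r c)))

assemble : ∀ {N s X} → (Fin N → Fin N → PFArray s s X) → PFArray (N * s) (N * s) X
assemble {s = s} B p q =
  let (I , a) = remQuot s p
      (J , b) = remQuot s q
  in B I J a b

-- Only the shape of the skeleton A matters, so its filled cells carry no data.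

record CyclicallyBlockDiagonal {n X} (s k : ℕ) (S : PFArray n n X) : Set where
  field
    N          : ℕ
    A          : PFArray N N ⊤
    A-diagonal : CyclicallyDiagonal k A
    B          : Fin N → Fin N → PFArray s s X
    B-empty    : ∀ I J → A I J ≡ nothing → ∀ a b → B I J a b ≡ nothing
    size       : n ≡ N * s
    shift      : Fin n
    columns    : ∀ r c → S r c ≡ assemble B (cast size r) (cast size (shift ⊕ toℕ c))

{-# OPTIONS --safe #-}
-- Put w = 2n + 1, so that the modulus for k = t is k w and J consists of the multiples of w.
-- Replacing entries by their centred representatives, an integer H_k(n;k) becomes an array of integers
-- whose absolute values are exactly the non-multiples of w up to h = ⌊k w / 2⌋.  Passing from k to k + 2μ
-- only asks for new cells that carry, up to sign, the non-multiples of w in h + 1, …, h + μ w and whose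
-- rows and columns have sum zero.
--
-- (1) These numbers form four intervals [bⱼ, bⱼ + n) with b₀ + b₁ = b₂ + b₃.  Two diagonals carry b₀ + x
-- increasing and b₁ + x decreasing along the columns, the other two -(b₂ + x) and -(b₃ + x) likewise, shifted by
-- two columns: both kinds of sums then cancel.
--
-- (2), (3) A block ± (x, -(x + g); -(x + 2g), x + 3g) has row and column sums independent of x.  In (2) two block
-- diagonals with g = 1 and opposite signs cancel; in (3) two with g = 1 and one with g = 2 and the opposite
-- sign cancel, and 4 ∣ n lets the blocks with g = 2 be interlaced in pairs.
module Submission where

open import Defs
open import Data.Bool.Base using (Bool; true; false; if_then_else_)
open import Data.Fin.Base as Fin using (Fin; toℕ; opposite; cast; combine; remQuot)
open import Data.Fin.Patterns using (0F; 1F; 2F; 3F)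
open import Data.Fin.Permutation using (Permutation′; permutation; _⟨$⟩ʳ_; _⟨$⟩ˡ_; inverseˡ; inverseʳ)
import Data.Fin.Properties as Fin
open import Data.Fin.Subset using (Subset; inside; outside; _∈_; ∣_∣)
open import Data.Fin.Subset.Properties using (∣⊥∣≡0)
open import Data.Integer.Base as ℤ using (ℤ; 0ℤ; -[1+_])
import Data.Integer.Properties as ℤ
import Data.Integer.Tactic.RingSolver as ℤSolver
open import Data.List.Base as List using (List; []; _∷_; _++_; length; map; mapMaybe; catMaybes; allFin; tabulate)
import Data.List.Properties as List
open import Data.List.Membership.Propositional using () renaming (_∈_ to _∈ˡ_)
open import Data.List.Membership.Propositional.Properties using (∈-tabulate⁺; ∈-tabulate⁻)
open import Data.List.Relation.Binary.Permutation.Propositional using (_↭_; ↭-refl; ↭-trans; ↭-prep; ↭-swap; ↭⇒↭ₛ)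
open import Data.List.Relation.Binary.Permutation.Propositional.Properties using (↭-length)
import Data.List.Relation.Binary.Permutation.Setoid.Properties as ↭ₛ
open import Data.List.Relation.Unary.All as All using (All; []; _∷_)
import Data.List.Relation.Unary.All.Properties as All
open import Data.List.Relation.Unary.AllPairs using (AllPairs; []; _∷_)
import Data.List.Relation.Unary.AllPairs.Properties as AllPairs
open import Data.List.Relation.Unary.Any using (here; there)
open import Data.Maybe using (Is-just)
open import Data.Maybe.Base as Maybe using (Maybe; just; nothing)
open import Data.Maybe.Relation.Unary.Any using (just)
open import Data.Nat.Base hiding (∣_-_∣; parity)
open import Data.Nat.Divisibility
open import Data.Nat.DivMod hiding (result)
open import Data.Nat.Properties
open import Algebra.Properties.Semiring.Sum +-*-semiring using (sum; sum-cong-≗; sum-permute; ∑-distrib-+; *-distribʳ-sum)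
import Data.Nat.Tactic.RingSolver as ℕSolver
open import Data.Product.Base using (_×_; _,_; ∃-syntax; proj₁; proj₂; uncurry)
open import Data.Sign.Base as Sign using (Sign)
open import Data.Sum.Base as Sum using (_⊎_; inj₁; inj₂)
open import Data.Unit.Base using (⊤; tt)
open import Data.Vec.Base as Vec using ([]; _∷_; lookup; concat; replicate)
import Data.Vec.Properties as Vec
open import Function.Base using (_∘_; id; case_of_)
open import Function.Bundles using (_⇔_; mk⇔; Equivalence; _↔_; mk↔ₛ′; module Inverse)
open import Function.Construct.Composition using (_↔-∘_)
open import Function.Construct.Symmetry using (↔-sym)
open import Relation.Binary.PropositionalEquality hiding (J)
open import Relation.Nullary using (¬_; contradiction)
open import Relation.Nullary.Decidable using (Dec; yes; no; does; dec-true; dec-false)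

-- Stacking layers on a partially filled array

-- The old and the new array live over different moduli, k w and (k + 2μ) w. Residue classes do not
-- carry over from one to the other, but their centred representatives do, and w = 2n + 1 does not
-- depend on k. So the work happens over ℤ and is reduced only at the end. The one ambiguous
-- representative is that of v/2 for even v. It is a multiple of w because w is odd, and old entries
-- of this size do no harm because the modulus grows.
--
-- New cells come in layers, one cell in each row and each column. A layer raises every count of
-- filled cells by one and leaves two sums to check. A cyclic diagonal is one layer, a diagonal of 2
-- × 2 blocks is two.
--
-- The equation b₀ + b₁ = b₂ + b₃ reflects a symmetry: the non-multiples of w in the range are
-- invariant under a reflection, for k even about a multiple of w, for k odd about a point midway
-- between two. The two outer intervals are therefore set against the two inner ones.

mapMaybe-allFin : ∀ {n} {X : Set} (f : Fin n → Maybe X) → mapMaybe f (allFin n) ≡ catMaybes (tabulate f)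
mapMaybe-allFin f = cong catMaybes (List.map-tabulate id f)

-- A permutation is enough, since only lengths and sums of rows and columns are read off later; the
-- place of the new entry never has to be tracked.
catMaybes-insert : ∀ {n} {X : Set} (f g : Fin n → Maybe X) i {x} → f i ≡ nothing → g i ≡ just x →
  (∀ j → j ≢ i → g j ≡ f j) → catMaybes (tabulate g) ↭ x ∷ catMaybes (tabulate f)
catMaybes-insert f g Fin.zero f≡ g≡ rest
  rewrite f≡ | g≡ | List.tabulate-cong (λ j → rest (Fin.suc j) λ ()) = ↭-refl
catMaybes-insert f g (Fin.suc i) f≡ g≡ rest rewrite rest Fin.zero (λ ()) with f Fin.zero
... | nothing = ih
  where ih = catMaybes-insert (f ∘ Fin.suc) (g ∘ Fin.suc) i f≡ g≡ (λ j j≢i → rest (Fin.suc j) (j≢i ∘ Fin.suc-injective))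
... | just y = ↭-trans (↭-prep y ih) (↭-swap y _ ↭-refl)
  where ih = catMaybes-insert (f ∘ Fin.suc) (g ∘ Fin.suc) i f≡ g≡ (λ j j≢i → rest (Fin.suc j) (j≢i ∘ Fin.suc-injective))

mapMaybe-insert : ∀ {n} {X : Set} (f g : Fin n → Maybe X) i {x} → f i ≡ nothing → g i ≡ just x →
  (∀ j → j ≢ i → g j ≡ f j) → mapMaybe g (allFin n) ↭ x ∷ mapMaybe f (allFin n)
mapMaybe-insert f g i f≡ g≡ rest rewrite mapMaybe-allFin f | mapMaybe-allFin g = catMaybes-insert f g i f≡ g≡ rest

-- A layer has one entry in every column c, namely val c in the row cells ⟨$⟩ʳ c.
record Layer (n : ℕ) : Set where
  field
    cells : Permutation′ n
    val   : Fin n → ℤ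

  rowOf colOf : Fin n → Fin n
  rowOf c = cells ⟨$⟩ʳ c
  colOf r = cells ⟨$⟩ˡ r

  rowVal : Fin n → ℤ
  rowVal r = val (colOf r)

open Layer public

Apart : ∀ {n} → Layer n → Layer n → Set
Apart l l′ = ∀ c → rowOf l c ≢ rowOf l′ c

Free : ∀ {n} → PFArray n n ℤ → Layer n → Set
Free A l = ∀ c → A (rowOf l c) c ≡ nothing

record Fits {n} (A : PFArray n n ℤ) (ls : List (Layer n)) : Set where
  constructor fits
  field
    free  : All (Free A) ls
    apart : AllPairs Apart ls

-- Where layers meet, the head of the list would win. Under `Fits` they meet neither each other nor
-- a filled cell of `A`, so nothing is overwritten.
stack : ∀ {n} → List (Layer n) → PFArray n n ℤ → PFArray n n ℤ
stack []       A r c = A r c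
stack (l ∷ ls) A r c = if does (r Fin.≟ rowOf l c) then just (val l c) else stack ls A r c

module _ {n} (A : PFArray n n ℤ) where

  stack-top : ∀ l ls c → stack (l ∷ ls) A (rowOf l c) c ≡ just (val l c)
  stack-top l ls c rewrite dec-true (rowOf l c Fin.≟ rowOf l c) refl = refl

  stack-below : ∀ l ls {r c} → r ≢ rowOf l c → stack (l ∷ ls) A r c ≡ stack ls A r c
  stack-below l ls {r} {c} r≢ rewrite dec-false (r Fin.≟ rowOf l c) r≢ = refl

  stack-outside : ∀ ls {r c} → All (λ l → r ≢ rowOf l c) ls → stack ls A r c ≡ A r c
  stack-outside []       []         = refl
  stack-outside (l ∷ ls) (r≢ ∷ r≢s) = trans (stack-below l ls r≢) (stack-outside ls r≢s)

  stack-free : ∀ l ls → Fits A (l ∷ ls) → ∀ c → stack ls A (rowOf l c) c ≡ nothing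
  stack-free l ls (fits (fr ∷ _) (ap ∷ _)) c = trans (stack-outside ls (All.map (λ ap′ → ap′ c) ap)) (fr c)

  Fits-tail : ∀ {l ls} → Fits A (l ∷ ls) → Fits A ls
  Fits-tail (fits (_ ∷ fr) (_ ∷ ap)) = fits fr ap

  row-stack : ∀ ls → Fits A ls → ∀ r → row (stack ls A) r ↭ map (λ l → rowVal l r) ls ++ row A r
  row-stack []       _ r = ↭-refl
  row-stack (l ∷ ls) ft r = ↭-trans
    (mapMaybe-insert (stack ls A r) (stack (l ∷ ls) A r) (colOf l r)
      -- The facts about layers are indexed by columns, so the row `r` is reached as
      -- `rowOf l (colOf l r)`.
      (subst (λ r′ → stack ls A r′ (colOf l r) ≡ nothing) (inverseʳ (cells l)) (stack-free l ls ft (colOf l r)))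
      (subst (λ r′ → stack (l ∷ ls) A r′ (colOf l r) ≡ just (rowVal l r)) (inverseʳ (cells l)) (stack-top l ls (colOf l r)))
      (λ c c≢ → stack-below l ls λ r≡ → c≢ (trans (sym (inverseˡ (cells l))) (cong (colOf l) (sym r≡)))))
    (↭-prep _ (row-stack ls (Fits-tail ft) r))

  col-stack : ∀ ls → Fits A ls → ∀ c → col (stack ls A) c ↭ map (λ l → val l c) ls ++ col A c
  col-stack []       _ c = ↭-refl
  col-stack (l ∷ ls) ft c = ↭-trans
    (mapMaybe-insert (λ r → stack ls A r c) (λ r → stack (l ∷ ls) A r c) (rowOf l c)
      (stack-free l ls ft c) (stack-top l ls c) (λ r r≢ → stack-below l ls r≢))
    (↭-prep _ (col-stack ls (Fits-tail ft) c))

  stack-keeps : ∀ ls → Fits A ls → ∀ {r c x} → A r c ≡ just x → stack ls A r c ≡ just x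
  stack-keeps ls (fits free _) {r} {c} A≡ = trans (stack-outside ls (All.map (λ {l} → apart′ l) free)) A≡
    where
    apart′ : ∀ l → Free A l → r ≢ rowOf l c
    apart′ l fr refl with () ← trans (sym A≡) (fr c)

  stack-entry : ∀ ls → Fits A ls → ∀ {l} → l ∈ˡ ls → ∀ c → stack ls A (rowOf l c) c ≡ just (val l c)
  stack-entry (l ∷ ls) ft                    (here refl) c = stack-top l ls c
  stack-entry (l ∷ ls) ft@(fits _ (ap ∷ _)) (there l∈)  c =
    trans (stack-below l ls λ r≡ → All.lookup ap l∈ c (sym r≡)) (stack-entry ls (Fits-tail ft) l∈ c)

  stack-cell : ∀ ls {r c x} → stack ls A r c ≡ just x → A r c ≡ just x ⊎ (∃[ l ] (l ∈ˡ ls × r ≡ rowOf l c × x ≡ val l c))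
  stack-cell []       eq = inj₁ eq
  stack-cell (l ∷ ls) {r} {c} eq with r Fin.≟ rowOf l c
  stack-cell (l ∷ ls) refl | yes r≡ = inj₂ (l , here refl , r≡ , refl)
  stack-cell (l ∷ ls) eq   | no  r≢ with stack-cell ls eq
  ... | inj₁ old = inj₁ old
  ... | inj₂ (l′ , l∈ , r≡ , x≡) = inj₂ (l′ , there l∈ , r≡ , x≡)

-- Centred residues

toℕ-mod : ∀ a v .{{_ : NonZero v}} → toℕ (a mod v) ≡ a % v
toℕ-mod a v = Fin.toℕ-fromℕ< (m%n<n a v)

[m%d+n]%d≡[m+n]%d : ∀ m n d .{{_ : NonZero d}} → (m % d + n) % d ≡ (m + n) % d
[m%d+n]%d≡[m+n]%d m n d = begin
  (m % d + n) % d           ≡⟨ %-distribˡ-+ (m % d) n d ⟩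
  (m % d % d + n % d) % d   ≡⟨ cong (λ x → (x + n % d) % d) (m%n%n≡m%n m d) ⟩
  (m % d + n % d) % d       ≡⟨ %-distribˡ-+ m n d ⟨
  (m + n) % d               ∎
  where open ≡-Reasoning

double-⌊n/2⌋≤n : ∀ n → 2 * ⌊ n /2⌋ ≤ n
double-⌊n/2⌋≤n n = begin
  2 * ⌊ n /2⌋             ≡⟨ cong (⌊ n /2⌋ +_) (+-identityʳ _) ⟩
  ⌊ n /2⌋ + ⌊ n /2⌋       ≤⟨ +-monoʳ-≤ ⌊ n /2⌋ (⌊n/2⌋≤⌈n/2⌉ n) ⟩
  ⌊ n /2⌋ + ⌈ n /2⌉       ≡⟨ ⌊n/2⌋+⌈n/2⌉≡n n ⟩
  n                       ∎
  where open ≤-Reasoning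

≤-half⁻ : ∀ {m n} → m ≤ ⌊ n /2⌋ → 2 * m ≤ n
≤-half⁻ {m} {n} m≤ = ≤-trans (*-monoʳ-≤ 2 m≤) (double-⌊n/2⌋≤n n)

≤-half⁺ : ∀ {m n} → 2 * m ≤ n → m ≤ ⌊ n /2⌋
≤-half⁺ {m} {n} 2m≤n = subst (_≤ ⌊ n /2⌋)
  (sym (trans (n≡⌊n+n/2⌋ m) (cong (λ k → ⌊ m + k /2⌋) (sym (+-identityʳ m))))) (⌊n/2⌋-mono 2m≤n)

module Residue (v : ℕ) .{{_ : NonZero v}} where
  open ℤMod v

  mod-toℕ : ∀ x → toℕ x mod v ≡ x
  mod-toℕ x = Fin.toℕ-injective (trans (toℕ-mod (toℕ x) v) (m<n⇒m%n≡m (Fin.toℕ<n x)))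

  toℕ-0ᵥ : toℕ 0ᵥ ≡ 0
  toℕ-0ᵥ = trans (toℕ-mod 0 v) (m<n⇒m%n≡m (>-nonZero⁻¹ v))

  toℕ-+ᵥ : ∀ x y → toℕ (x +ᵥ y) ≡ (toℕ x + toℕ y) % v
  toℕ-+ᵥ x y = toℕ-mod (toℕ x + toℕ y) v

  toℕ-neg : ∀ x → toℕ (-ᵥ x) ≡ (v ∸ toℕ x) % v
  toℕ-neg x = toℕ-mod (v ∸ toℕ x) v

  toℕ-neg-pos : ∀ {x y} → toℕ x ≡ suc y → toℕ (-ᵥ x) ≡ v ∸ suc y
  toℕ-neg-pos {x} {y} eq = begin
    toℕ (-ᵥ x)       ≡⟨ toℕ-neg x ⟩
    (v ∸ toℕ x) % v  ≡⟨ m<n⇒m%n≡m (subst (λ z → v ∸ z < v) (sym eq) (∸-monoʳ-< {v} {suc y} {0} z<s (subst (_≤ v) eq (Fin.toℕ≤n x)))) ⟩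
    v ∸ toℕ x        ≡⟨ cong (v ∸_) eq ⟩
    v ∸ suc y        ∎
    where open ≡-Reasoning

  neg-involutive : ∀ x → -ᵥ (-ᵥ x) ≡ x
  neg-involutive x with toℕ x in eq
  ... | zero = Fin.toℕ-injective (begin
    toℕ (-ᵥ (v mod v))  ≡⟨ toℕ-neg (v mod v) ⟩
    (v ∸ toℕ (v mod v)) % v ≡⟨ cong (λ z → (v ∸ z) % v) (trans (toℕ-mod v v) (n%n≡0 v)) ⟩
    v % v               ≡⟨ n%n≡0 v ⟩
    0                   ≡⟨ eq ⟨
    toℕ x               ∎)
    where open ≡-Reasoning
  ... | suc y = Fin.toℕ-injective (begin
    toℕ (-ᵥ ((v ∸ suc y) mod v))       ≡⟨ toℕ-neg ((v ∸ suc y) mod v) ⟩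
    (v ∸ toℕ ((v ∸ suc y) mod v)) % v  ≡⟨ cong (λ z → (v ∸ z) % v) (trans (cong (λ z → toℕ ((v ∸ z) mod v)) (sym eq)) (toℕ-neg-pos {x} eq)) ⟩
    (v ∸ (v ∸ suc y)) % v              ≡⟨ cong (_% v) (m∸[m∸n]≡n (subst (_≤ v) eq (Fin.toℕ≤n x))) ⟩
    suc y % v                          ≡⟨ m<n⇒m%n≡m (subst (_< v) eq (Fin.toℕ<n x)) ⟩
    suc y                              ≡⟨ eq ⟨
    toℕ x                              ∎)
    where open ≡-Reasoning

  +ᵥ-cancelʳ : ∀ x y → (y +ᵥ x) +ᵥ (-ᵥ x) ≡ y
  +ᵥ-cancelʳ x y = Fin.toℕ-injective (begin
    toℕ ((y +ᵥ x) +ᵥ (-ᵥ x))                       ≡⟨ toℕ-+ᵥ (y +ᵥ x) (-ᵥ x) ⟩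
    (toℕ (y +ᵥ x) + toℕ (-ᵥ x)) % v                ≡⟨ cong₂ (λ a b → (a + b) % v) (toℕ-+ᵥ y x) (toℕ-neg x) ⟩
    ((toℕ y + toℕ x) % v + (v ∸ toℕ x) % v) % v    ≡⟨ %-distribˡ-+ (toℕ y + toℕ x) (v ∸ toℕ x) v ⟨
    (toℕ y + toℕ x + (v ∸ toℕ x)) % v              ≡⟨ cong (_% v) (+-assoc (toℕ y) (toℕ x) (v ∸ toℕ x)) ⟩
    (toℕ y + (toℕ x + (v ∸ toℕ x))) % v            ≡⟨ cong (λ z → (toℕ y + z) % v) (m+[n∸m]≡n (Fin.toℕ≤n x)) ⟩
    (toℕ y + v) % v                                ≡⟨ [m+n]%n≡m%n (toℕ y) v ⟩
    toℕ y % v                                      ≡⟨ m<n⇒m%n≡m (Fin.toℕ<n y) ⟩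
    toℕ y                                          ∎)
    where open ≡-Reasoning

  translation : Fin v → Permutation′ v
  translation x = permutation (_+ᵥ x) (_+ᵥ (-ᵥ x))
    (λ y → trans (cong ((y +ᵥ (-ᵥ x)) +ᵥ_) (sym (neg-involutive x))) (+ᵥ-cancelʳ (-ᵥ x) y))
    (+ᵥ-cancelʳ x)

  centred-low : ∀ (x : Fin v) → 2 * toℕ x ≤ v → centred x ≡ ℤ.+ toℕ x
  centred-low x 2x≤v with toℕ x ≤ᵇ ⌊ v /2⌋ | ≤⇒≤ᵇ (≤-half⁺ {toℕ x} 2x≤v)
  ... | true | _ = refl

  centred-high : ∀ (x : Fin v) → v < 2 * toℕ x → centred x ≡ toℕ x ℤ.⊖ v
  centred-high x v<2x with toℕ x ≤ᵇ ⌊ v /2⌋ | ≤ᵇ⇒≤ (toℕ x) ⌊ v /2⌋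
  ... | false | _  = refl
  ... | true  | x≤ = contradiction (≤-half⁻ {toℕ x} (x≤ tt)) (<⇒≱ v<2x)

  2[v∸y]<v : ∀ {y} → y ≤ v → v < 2 * y → 2 * (v ∸ y) < v
  2[v∸y]<v {y} y≤v v<2y = +-cancelʳ-< (2 * y) _ _ (begin-strict
    2 * (v ∸ y) + 2 * y   ≡⟨ *-distribˡ-+ 2 (v ∸ y) y ⟨
    2 * (v ∸ y + y)       ≡⟨ cong (2 *_) (m∸n+n≡m y≤v) ⟩
    2 * v                 ≡⟨ cong (v +_) (+-identityʳ v) ⟩
    v + v                 <⟨ +-monoʳ-< v v<2y ⟩
    v + 2 * y             ∎)
    where open ≤-Reasoning

  v<2[v∸y] : ∀ {y} → 2 * y < v → v < 2 * (v ∸ y)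
  v<2[v∸y] {y} 2y<v = +-cancelʳ-< (2 * y) _ _ (begin-strict
    v + 2 * y             <⟨ +-monoʳ-< v 2y<v ⟩
    v + v                 ≡⟨ cong (v +_) (+-identityʳ v) ⟨
    2 * v                 ≡⟨ cong (2 *_) (m∸n+n≡m (≤-trans (m≤m+n y _) (<⇒≤ 2y<v))) ⟨
    2 * (v ∸ y + y)       ≡⟨ *-distribˡ-+ 2 (v ∸ y) y ⟩
    2 * (v ∸ y) + 2 * y   ∎)
    where open ≤-Reasoning

  centred-bound : ∀ (x : Fin v) → 2 * ℤ.∣ centred x ∣ ≤ v
  centred-bound x with 2 * toℕ x ≤? v
  ... | yes 2x≤v rewrite centred-low x 2x≤v = 2x≤v
  ... | no  2x≰v rewrite centred-high x (≰⇒> 2x≰v) | ℤ.∣⊖∣-< (Fin.toℕ<n x) =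
    <⇒≤ (2[v∸y]<v (Fin.toℕ≤n x) (≰⇒> 2x≰v))

  centred-cong : ∀ (x : Fin v) → ∃[ q ] centred x ≡ ℤ.+ toℕ x ℤ.+ q ℤ.* ℤ.+ v
  centred-cong x with 2 * toℕ x ≤? v
  ... | yes 2x≤v = 0ℤ , trans (centred-low x 2x≤v) (sym (ℤ.+-identityʳ _))
  ... | no  2x≰v = ℤ.- ℤ.1ℤ , trans (centred-high x (≰⇒> 2x≰v))
    (trans (sym (ℤ.m-n≡m⊖n (toℕ x) v)) (cong (λ z → ℤ.+ toℕ x ℤ.+ z) (sym (ℤ.-1*i≡-i (ℤ.+ v)))))

  residue : ℤ → Fin v
  residue (ℤ.+ y)  = y mod v
  residue -[1+ y ] = -ᵥ (suc y mod v)

  residue-neg : ∀ y → residue (ℤ.- ℤ.+ y) ≡ -ᵥ (y mod v)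
  residue-neg (suc y) = refl
  residue-neg zero    = Fin.toℕ-injective (begin
    toℕ (0 mod v)               ≡⟨ toℕ-0ᵥ ⟩
    0                           ≡⟨ n%n≡0 v ⟨
    v % v                       ≡⟨ cong (λ z → (v ∸ z) % v) toℕ-0ᵥ ⟨
    (v ∸ toℕ (0 mod v)) % v     ≡⟨ toℕ-neg (0 mod v) ⟨
    toℕ (-ᵥ (0 mod v))          ∎)
    where open ≡-Reasoning

  -- The bound must be strict: `centred` picks the positive representative of v/2, so -v/2 would
  -- come back as v/2.
  centred-residue : ∀ z → 2 * ℤ.∣ z ∣ < v → centred (residue z) ≡ z
  centred-residue (ℤ.+ y) 2y<v = trans (centred-low (y mod v) (subst (λ z → 2 * z ≤ v) (sym y≡) (<⇒≤ 2y<v))) (cong ℤ.+_ y≡)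
    where
    y≡ : toℕ (y mod v) ≡ y
    y≡ = trans (toℕ-mod y v) (m<n⇒m%n≡m (≤-<-trans (m≤m+n y _) 2y<v))
  centred-residue -[1+ y ] 2y<v = begin
    centred (-ᵥ (suc y mod v))   ≡⟨ centred-high (-ᵥ (suc y mod v)) (subst (λ z → v < 2 * z) (sym neg≡) (v<2[v∸y] {suc y} 2y<v)) ⟩
    toℕ (-ᵥ (suc y mod v)) ℤ.⊖ v ≡⟨ cong (ℤ._⊖ v) neg≡ ⟩
    (v ∸ suc y) ℤ.⊖ v            ≡⟨ ℤ.⊖-≤ (m∸n≤m v (suc y)) ⟩
    ℤ.- ℤ.+ (v ∸ (v ∸ suc y))    ≡⟨ cong (λ z → ℤ.- ℤ.+ z) (m∸[m∸n]≡n (<⇒≤ 1+y<v)) ⟩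
    -[1+ y ]                     ∎
    where
    open ≡-Reasoning
    1+y<v : suc y < v
    1+y<v = ≤-<-trans (m≤m+n (suc y) _) 2y<v
    neg≡ : toℕ (-ᵥ (suc y mod v)) ≡ v ∸ suc y
    neg≡ = toℕ-neg-pos {suc y mod v} (trans (toℕ-mod (suc y) v) (m<n⇒m%n≡m 1+y<v))

  toℕ-mod-small : ∀ {y} → y < v → toℕ (y mod v) ≡ y
  toℕ-mod-small {y} y<v = trans (toℕ-mod y v) (m<n⇒m%n≡m y<v)

  0<y≤v/2⇒y<v : ∀ {y} → 0 < y → 2 * y ≤ v → y < v
  0<y≤v/2⇒y<v {y} 0<y 2y≤v = ≤-trans (m<m+n y (≤-trans 0<y (m≤m+n y 0))) 2y≤v

  centred-mod : ∀ {y} → 0 < y → 2 * y ≤ v → centred (y mod v) ≡ ℤ.+ y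
  centred-mod {y} 0<y 2y≤v = trans (centred-low (y mod v) (subst (λ z → 2 * z ≤ v) (sym y≡) 2y≤v)) (cong ℤ.+_ y≡)
    where
    y≡ : toℕ (y mod v) ≡ y
    y≡ = toℕ-mod-small (0<y≤v/2⇒y<v 0<y 2y≤v)

  -- If 2 y = v, then y and - y are the same class.
  centred-neg-mod : ∀ {y} → 0 < y → 2 * y ≤ v → centred (-ᵥ (y mod v)) ≡ ℤ.+ y ⊎ centred (-ᵥ (y mod v)) ≡ ℤ.- ℤ.+ y
  centred-neg-mod {y} 0<y 2y≤v with m≤n⇒m<n∨m≡n 2y≤v
  ... | inj₁ 2y<v = inj₂ (trans (cong centred (sym (residue-neg y))) (centred-residue (ℤ.- ℤ.+ y) (subst (λ z → 2 * z < v) (sym (ℤ.∣-i∣≡∣i∣ (ℤ.+ y))) 2y<v)))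
  ... | inj₂ 2y≡v = inj₁ (trans (cong centred -y≡y) (centred-mod 0<y 2y≤v))
    where
    open ≡-Reasoning
    -y≡y : -ᵥ (y mod v) ≡ y mod v
    -y≡y = cong (_mod v) (begin
      v ∸ toℕ (y mod v)   ≡⟨ cong₂ _∸_ (sym 2y≡v) (toℕ-mod-small (0<y≤v/2⇒y<v 0<y 2y≤v)) ⟩
      2 * y ∸ y           ≡⟨ m+n∸m≡n y (y + 0) ⟩
      y + 0               ≡⟨ +-identityʳ y ⟩
      y                   ∎)

  sum-cong-mod : ∀ xs → ∃[ q ] sumℤ (map centred xs) ≡ ℤ.+ toℕ (sumᵥ xs) ℤ.+ q ℤ.* ℤ.+ v
  sum-cong-mod [] = 0ℤ , cong (λ z → ℤ.+ z ℤ.+ 0ℤ) (sym toℕ-0ᵥ)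
  sum-cong-mod (x ∷ xs) with centred-cong x | sum-cong-mod xs
  ... | p , x≡ | q , s≡ = p ℤ.+ q ℤ.+ ℤ.+ ((a + b) / v) , (begin
    centred x ℤ.+ sumℤ (map centred xs)                        ≡⟨ cong₂ ℤ._+_ x≡ s≡ ⟩
    (ℤ.+ a ℤ.+ p ℤ.* ℤ.+ v) ℤ.+ (ℤ.+ b ℤ.+ q ℤ.* ℤ.+ v)        ≡⟨ regroup (ℤ.+ a) (ℤ.+ b) p q (ℤ.+ v) ⟩
    (ℤ.+ a ℤ.+ ℤ.+ b) ℤ.+ (p ℤ.+ q) ℤ.* ℤ.+ v                  ≡⟨ cong (ℤ._+ (p ℤ.+ q) ℤ.* ℤ.+ v) divMod ⟩
    (ℤ.+ toℕ (x +ᵥ sumᵥ xs) ℤ.+ d ℤ.* ℤ.+ v) ℤ.+ (p ℤ.+ q) ℤ.* ℤ.+ v ≡⟨ regroup′ (ℤ.+ toℕ (x +ᵥ sumᵥ xs)) d (p ℤ.+ q) (ℤ.+ v) ⟩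
    ℤ.+ toℕ (x +ᵥ sumᵥ xs) ℤ.+ (p ℤ.+ q ℤ.+ d) ℤ.* ℤ.+ v       ∎)
    where
    open ≡-Reasoning
    a b : ℕ
    a = toℕ x
    b = toℕ (sumᵥ xs)
    d : ℤ
    d = ℤ.+ ((a + b) / v)
    regroup : ∀ a b p q v → (a ℤ.+ p ℤ.* v) ℤ.+ (b ℤ.+ q ℤ.* v) ≡ (a ℤ.+ b) ℤ.+ (p ℤ.+ q) ℤ.* v
    regroup = ℤSolver.solve-∀
    regroup′ : ∀ s d e v → (s ℤ.+ d ℤ.* v) ℤ.+ e ℤ.* v ≡ s ℤ.+ (e ℤ.+ d) ℤ.* v
    regroup′ = ℤSolver.solve-∀
    divMod : ℤ.+ (a + b) ≡ ℤ.+ toℕ (x +ᵥ sumᵥ xs) ℤ.+ d ℤ.* ℤ.+ v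
    divMod = begin
      ℤ.+ (a + b)                                        ≡⟨ cong ℤ.+_ (m≡m%n+[m/n]*n (a + b) v) ⟩
      ℤ.+ ((a + b) % v + (a + b) / v * v)                ≡⟨ cong₂ (λ s t → ℤ.+ s ℤ.+ t) (sym (toℕ-+ᵥ x (sumᵥ xs))) (ℤ.pos-* ((a + b) / v) v) ⟩
      ℤ.+ toℕ (x +ᵥ sumᵥ xs) ℤ.+ d ℤ.* ℤ.+ v             ∎

  -- The two sums are congruent modulo v, and the only residue below v divisible by v is 0. For a
  -- new array it is thus enough to check sums over ℤ.
  sumℤ≡0⇒sumᵥ≡0 : ∀ xs → sumℤ (map centred xs) ≡ 0ℤ → sumᵥ xs ≡ 0ᵥ
  sumℤ≡0⇒sumᵥ≡0 xs sum≡0 with sum-cong-mod xs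
  ... | q , s≡ = Fin.toℕ-injective (trans (residue≡0 (toℕ (sumᵥ xs)) (Fin.toℕ<n (sumᵥ xs)) v∣s) (sym toℕ-0ᵥ))
    where
    s : ℤ
    s = ℤ.+ toℕ (sumᵥ xs)
    s≡-qv : s ≡ (ℤ.- q) ℤ.* ℤ.+ v
    s≡-qv = begin
      s                                              ≡⟨ move s q (ℤ.+ v) ⟩
      (s ℤ.+ q ℤ.* ℤ.+ v) ℤ.+ (ℤ.- q) ℤ.* ℤ.+ v      ≡⟨ cong (ℤ._+ (ℤ.- q) ℤ.* ℤ.+ v) (trans (sym s≡) sum≡0) ⟩
      0ℤ ℤ.+ (ℤ.- q) ℤ.* ℤ.+ v                       ≡⟨ ℤ.+-identityˡ _ ⟩
      (ℤ.- q) ℤ.* ℤ.+ v                              ∎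
      where
      open ≡-Reasoning
      move : ∀ s q v → s ≡ (s ℤ.+ q ℤ.* v) ℤ.+ (ℤ.- q) ℤ.* v
      move = ℤSolver.solve-∀
    v∣s : v ∣ toℕ (sumᵥ xs)
    v∣s = divides ℤ.∣ ℤ.- q ∣ (trans (cong ℤ.∣_∣ s≡-qv) (ℤ.abs-* (ℤ.- q) (ℤ.+ v)))
    residue≡0 : ∀ m → m < v → v ∣ m → m ≡ 0
    residue≡0 zero    _   _   = refl
    residue≡0 (suc m) m<v v∣m = contradiction (∣⇒≤ v∣m) (<⇒≱ m<v)

-- Subgroups of ℤ_v

indicator : Bool → ℕ
indicator true  = 1
indicator false = 0

∣p∣≡sum : ∀ {n} (p : Subset n) → ∣ p ∣ ≡ sum (λ i → indicator (lookup p i))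
∣p∣≡sum []            = refl
∣p∣≡sum (inside  ∷ p) = cong suc (∣p∣≡sum p)
∣p∣≡sum (outside ∷ p) = ∣p∣≡sum p

-- Translation by x permutes J, so it preserves the sum of the elements of J modulo v;
-- but it also adds x to each of the ∣J∣ terms.
module _ (v : ℕ) .{{_ : NonZero v}} (J : Subset v) (isSubgroup : ℤMod.IsSubgroup v J) where
  open ℤMod v
  open IsSubgroup isSubgroup
  open Residue v

  indicator-translate : ∀ {x} → x ∈ J → ∀ y → indicator (lookup J (y +ᵥ x)) ≡ indicator (lookup J y)
  indicator-translate {x} x∈J y with lookup J y in y? | lookup J (y +ᵥ x) in yx?
  ... | true  | true  = refl
  ... | false | false = refl
  ... | true  | false with () ← trans (sym yx?) (Vec.[]=⇒lookup (+-closed (Vec.lookup⇒[]= y J y?) x∈J))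
  ... | false | true
    with () ← trans (sym y?) (Vec.[]=⇒lookup (subst (_∈ J) (+ᵥ-cancelʳ x y) (+-closed (Vec.lookup⇒[]= (y +ᵥ x) J yx?) (neg-closed x∈J))))

  order-annihilates : ∀ {x} → x ∈ J → v ∣ ∣ J ∣ * toℕ x
  order-annihilates {x} x∈J = divides (sum Q) (+-cancelˡ-≡ (sum (λ y → χ y * toℕ y)) _ _ (begin
    S + ∣ J ∣ * toℕ x                                          ≡⟨ cong (λ z → S + z * toℕ x) (∣p∣≡sum J) ⟩
    S + sum χ * toℕ x                                          ≡⟨ cong (S +_) (*-distribʳ-sum (toℕ x) χ) ⟩
    S + sum (λ y → χ y * toℕ x)                                ≡⟨ ∑-distrib-+ (λ y → χ y * toℕ y) (λ y → χ y * toℕ x) ⟨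
    sum (λ y → χ y * toℕ y + χ y * toℕ x)                      ≡⟨ sum-cong-≗ step ⟩
    sum (λ y → χ (y +ᵥ x) * toℕ (y +ᵥ x) + Q y * v)            ≡⟨ ∑-distrib-+ (λ y → χ (y +ᵥ x) * toℕ (y +ᵥ x)) (λ y → Q y * v) ⟩
    sum (λ y → χ (y +ᵥ x) * toℕ (y +ᵥ x)) + sum (λ y → Q y * v) ≡⟨ cong₂ _+_ (sum-permute (λ y → χ y * toℕ y) (translation x)) (*-distribʳ-sum v Q) ⟨
    S + sum Q * v                                              ∎))
    where
    open ≡-Reasoning
    χ Q : Fin v → ℕ
    χ y = indicator (lookup J y)
    -- The carry: the number of times v is subtracted when y + x is reduced, counted for y in `J`
    -- only.
    Q y = χ y * ((toℕ y + toℕ x) / v)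
    S : ℕ
    S = sum (λ y → χ y * toℕ y)
    step : ∀ y → χ y * toℕ y + χ y * toℕ x ≡ χ (y +ᵥ x) * toℕ (y +ᵥ x) + Q y * v
    step y = begin
      χ y * toℕ y + χ y * toℕ x                              ≡⟨ *-distribˡ-+ (χ y) (toℕ y) (toℕ x) ⟨
      χ y * (toℕ y + toℕ x)                                  ≡⟨ cong (χ y *_) (m≡m%n+[m/n]*n (toℕ y + toℕ x) v) ⟩
      χ y * ((toℕ y + toℕ x) % v + (toℕ y + toℕ x) / v * v)  ≡⟨ *-distribˡ-+ (χ y) _ _ ⟩
      χ y * ((toℕ y + toℕ x) % v) + χ y * ((toℕ y + toℕ x) / v * v)
        ≡⟨ cong₂ _+_ (cong₂ _*_ (sym (indicator-translate x∈J y)) (sym (toℕ-+ᵥ y x))) (sym (*-assoc (χ y) _ v)) ⟩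
      χ (y +ᵥ x) * toℕ (y +ᵥ x) + Q y * v                    ∎

  -- From k w ∣ k x the factor k cancels. This half of the uniqueness of the subgroup is what
  -- covering needs: a non-multiple of w lies outside any `J` of order k.
  subgroup-multiples : ∀ {k w} .{{_ : NonZero k}} → ∣ J ∣ ≡ k → v ≡ k * w → ∀ {x} → x ∈ J → w ∣ toℕ x
  subgroup-multiples {k} {w} ∣J∣≡k v≡kw {x} x∈J = *-cancelˡ-∣ k (subst₂ (λ a b → a ∣ b * toℕ x) v≡kw ∣J∣≡k (order-annihilates x∈J))

∣p++q∣≡∣p∣+∣q∣ : ∀ {m n} (p : Subset m) (q : Subset n) → ∣ p Vec.++ q ∣ ≡ ∣ p ∣ + ∣ q ∣
∣p++q∣≡∣p∣+∣q∣ []            q = refl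
∣p++q∣≡∣p∣+∣q∣ (inside  ∷ p) q = cong suc (∣p++q∣≡∣p∣+∣q∣ p q)
∣p++q∣≡∣p∣+∣q∣ (outside ∷ p) q = ∣p++q∣≡∣p∣+∣q∣ p q

-- The periodic pattern has one element in each of k periods of length m + 1, so its order follows
-- by induction on k, and membership of `combine i j` depends on j alone.
multiples : ∀ k m → Subset (k * suc m)
multiples k m = concat (replicate k (inside ∷ replicate m outside))

∣multiples∣ : ∀ k m → ∣ multiples k m ∣ ≡ k
∣multiples∣ zero    m = refl
∣multiples∣ (suc k) m = cong suc (trans (∣p++q∣≡∣p∣+∣q∣ (replicate m outside) (multiples k m)) (cong₂ _+_ (∣⊥∣≡0 m) (∣multiples∣ k m)))

lookup-multiples : ∀ k m i j → lookup (multiples k m) (combine i j) ≡ lookup (inside ∷ replicate m outside) j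
lookup-multiples k m i j = trans (Vec.lookup-concat (replicate k _) i j) (cong (λ xs → lookup xs j) (Vec.lookup-replicate i _))

∈-multiples⁻ : ∀ k m {x} → x ∈ multiples k m → suc m ∣ toℕ x
∈-multiples⁻ k m {x} x∈ with Fin.combine-surjective {k} {suc m} x
... | i , Fin.zero  , refl = subst (suc m ∣_) (sym (trans (Fin.toℕ-combine i (Fin.zero {m})) (+-identityʳ _))) (m∣m*n (toℕ i))
... | i , Fin.suc j , refl
  with () ← trans (sym (Vec.[]=⇒lookup x∈)) (trans (lookup-multiples k m i (Fin.suc j)) (Vec.lookup-replicate j outside))

∈-multiples⁺ : ∀ k m {x} → suc m ∣ toℕ x → x ∈ multiples k m
∈-multiples⁺ k m {x} w∣x with Fin.combine-surjective {k} {suc m} x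
... | i , Fin.zero  , refl = Vec.lookup⇒[]= _ _ (lookup-multiples k m i Fin.zero)
... | i , Fin.suc j , refl = contradiction
  (∣⇒≤ (∣m+n∣m⇒∣n (subst (suc m ∣_) (Fin.toℕ-combine i (Fin.suc j)) w∣x) (m∣m*n (toℕ i))))
  (<⇒≱ (Fin.toℕ<n (Fin.suc j)))

∣m∣n⇒∣m∸n : ∀ {d m n} → n ≤ m → d ∣ m → d ∣ n → d ∣ m ∸ n
∣m∣n⇒∣m∸n n≤m d∣m d∣n = ∣m+n∣m⇒∣n (subst (_ ∣_) (sym (m+[n∸m]≡n n≤m)) d∣m) d∣n

module _ {v k m : ℕ} .{{_ : NonZero v}} where
  open ℤMod v
  open Residue v

  -- Stated for a variable `v`, so that the factorisation of a concrete modulus can be matched with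
  -- `refl`.
  multiples-subgroup : v ≡ k * suc m →
    ∃[ J ] (IsSubgroup J × ∣ J ∣ ≡ k × (∀ x → suc m ∣ toℕ x → x ∈ J))
  multiples-subgroup refl = multiples k m , isSubgroup , ∣multiples∣ k m , λ x → ∈-multiples⁺ k m
    where
    w∣v : suc m ∣ k * suc m
    w∣v = n∣m*n k
    isSubgroup : IsSubgroup (multiples k m)
    isSubgroup = record
      { 0∈J        = ∈-multiples⁺ k m (subst (suc m ∣_) (sym (toℕ-mod 0 v)) (%-presˡ-∣ (suc m ∣0) w∣v))
      ; +-closed   = λ {x} {y} x∈ y∈ → ∈-multiples⁺ k m (subst (suc m ∣_) (sym (toℕ-+ᵥ x y))
          (%-presˡ-∣ (∣m∣n⇒∣m+n (∈-multiples⁻ k m x∈) (∈-multiples⁻ k m y∈)) w∣v))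
      ; neg-closed = λ {x} x∈ → ∈-multiples⁺ k m (subst (suc m ∣_) (sym (toℕ-neg x))
          (%-presˡ-∣ (∣m∣n⇒∣m∸n (Fin.toℕ≤n x) w∣v (∈-multiples⁻ k m x∈)) w∣v))
      }

-- Heffter arrays as integer arrays

modulus-factors : ∀ n k → modulus n k k ≡ k * suc (2 * n)
modulus-factors = ring
  where
  ring : ∀ n k → 2 * n * k + k ≡ k * suc (2 * n)
  ring = ℕSolver.solve-∀

modulus-nonZero : ∀ n k .{{_ : NonZero k}} → NonZero (modulus n k k)
modulus-nonZero n k = >-nonZero (≤-trans (>-nonZero⁻¹ k) (m≤n+m k (2 * n * k)))

mapMaybe-map : ∀ {A B C : Set} (f : B → C) (g : A → Maybe B) xs → mapMaybe (Maybe.map f ∘ g) xs ≡ map f (mapMaybe g xs)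
mapMaybe-map f g []       = refl
mapMaybe-map f g (x ∷ xs) with g x
... | just _  = cong (f _ ∷_) (mapMaybe-map f g xs)
... | nothing = mapMaybe-map f g xs

map-just⁻ : ∀ {A B : Set} (f : A → B) m {y} → Maybe.map f m ≡ just y → ∃[ x ] (m ≡ just x × y ≡ f x)
map-just⁻ f (just x) refl = x , refl , refl

is-just⁺ : ∀ {A : Set} {m : Maybe A} {x} → m ≡ just x → Is-just m
is-just⁺ refl = just tt

is-just⁻ : ∀ {A : Set} {m : Maybe A} → Is-just m → ∃[ x ] m ≡ just x
is-just⁻ (just {x = x} _) = x , refl

not-just : ∀ {A : Set} {m : Maybe A} → ¬ Is-just m → m ≡ nothing
not-just {m = nothing} _ = refl
not-just {m = just _}  ¬filled = contradiction (just tt) ¬filled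

mapCells : ∀ {m n} {X Y : Set} → (X → Y) → PFArray m n X → PFArray m n Y
mapCells f A r c = Maybe.map f (A r c)

AppearsIn-map : ∀ {m n} {X Y : Set} (f : X → Y) {A : PFArray m n X} {x y} → y ≡ f x → AppearsIn x A → AppearsIn y (mapCells f A)
AppearsIn-map f refl (r , c , eq) = r , c , cong (Maybe.map f) eq

-- The case k = t, with residue classes replaced by their centred representatives.
record Heffterℤ (n k : ℕ) (Z : PFArray n n ℤ) : Set where
  field
    rowLength : ∀ r → length (row Z r) ≡ k
    colLength : ∀ c → length (col Z c) ≡ k
    rowZero   : ∀ r → sumℤ (row Z r) ≡ 0ℤ
    colZero   : ∀ c → sumℤ (col Z c) ≡ 0ℤ
    bounded   : ∀ {r c z} → Z r c ≡ just z → 2 * ℤ.∣ z ∣ ≤ modulus n k k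
    covered   : ∀ y → 2 * y ≤ modulus n k k → ¬ suc (2 * n) ∣ y → AppearsIn (ℤ.+ y) Z ⊎ AppearsIn (ℤ.- ℤ.+ y) Z

toℤ : ∀ {n k} .{{_ : NonZero k}} {A} → IsIntegerHeffter n k k A → Heffterℤ n k (mapCells centred A)
toℤ {n} {k} {A} isInteger = record
  { rowLength = λ r → trans (cong length (rows r)) (trans (List.length-map centred (row A r)) (rowFilled r))
  ; colLength = λ c → trans (cong length (cols c)) (trans (List.length-map centred (col A c)) (colFilled c))
  ; rowZero   = λ r → trans (cong sumℤ (rows r)) (rowSumℤ r)
  ; colZero   = λ c → trans (cong sumℤ (cols c)) (colSumℤ c)
  ; bounded   = λ {r} {c} eq → case map-just⁻ centred (A r c) eq of λ where
      (x , _ , refl) → centred-bound x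
  ; covered   = covered
  }
  where
  open IsIntegerHeffter isInteger
  open IsHeffter isHeffter
  v : ℕ
  v = modulus n k k
  instance
    v-nonZero : NonZero v
    v-nonZero = >-nonZero (≤-trans 0<t (m≤n+m k (2 * n * k)))
  open Residue v
  rows : ∀ r → row (mapCells centred A) r ≡ map centred (row A r)
  rows r = mapMaybe-map centred (A r) (allFin n)
  cols : ∀ c → col (mapCells centred A) c ≡ map centred (col A c)
  cols c = mapMaybe-map centred (λ r → A r c) (allFin n)

  w∣∈J : ∀ {x} → x ∈ J → suc (2 * n) ∣ toℕ x
  w∣∈J = subgroup-multiples v J isSubgroup {k} order (modulus-factors n k)

  0<y : ∀ {y} → ¬ suc (2 * n) ∣ y → 0 < y
  0<y w∤y = n≢0⇒n>0 λ where refl → w∤y (suc (2 * n) ∣0)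

  covered : ∀ y → 2 * y ≤ v → ¬ suc (2 * n) ∣ y →
    AppearsIn (ℤ.+ y) (mapCells centred A) ⊎ AppearsIn (ℤ.- ℤ.+ y) (mapCells centred A)
  covered y 2y≤v w∤y = Sum.[ (λ y∈A → inj₁ (AppearsIn-map centred (sym (centred-mod (0<y w∤y) 2y≤v)) y∈A))
    , (λ -y∈A → Sum.map (λ eq → AppearsIn-map centred (sym eq) -y∈A) (λ eq → AppearsIn-map centred (sym eq) -y∈A)
        (centred-neg-mod (0<y w∤y) 2y≤v)) ]′
    (covers (y mod v) (w∤y ∘ subst (suc (2 * n) ∣_) (toℕ-mod-small (0<y≤v/2⇒y<v (0<y w∤y) 2y≤v)) ∘ w∣∈J))

module _ {n k : ℕ} .{{_ : NonZero k}} where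

  private
    v : ℕ
    v = modulus n k k
    instance
      v-nonZero : NonZero v
      v-nonZero = modulus-nonZero n k

  open ℤMod v
  open Residue v

  -- Strictness is asked for separately: `Heffterℤ` alone does not rule out an entry of absolute
  -- value v/2 short of a counting argument, whereas passing to a larger modulus makes every old
  -- bound strict.
  fromℤ : ∀ {Z} → 0 < n → Heffterℤ n k Z → (∀ {r c z} → Z r c ≡ just z → 2 * ℤ.∣ z ∣ < v) →
    IsIntegerHeffter n k k (mapCells residue Z)
  fromℤ {Z} 0<n H strict = record
    { isHeffter = record
      { 0<n        = 0<n
      ; 0<k        = >-nonZero⁻¹ k
      ; 0<t        = >-nonZero⁻¹ k
      ; t∣2nk      = n∣m*n (2 * n)
      ; J          = J
      ; isSubgroup = isSubgroup
      ; order      = order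
      ; rowFilled  = λ r → trans (cong length (rows r)) (trans (List.length-map residue (row Z r)) (rowLength r))
      ; colFilled  = λ c → trans (cong length (cols c)) (trans (List.length-map residue (col Z c)) (colLength c))
      ; covers     = λ x x∉J → covers x (x∉J ∘ ∈J x)
      ; rowSum     = λ r → sumℤ≡0⇒sumᵥ≡0 (row (mapCells residue Z) r) (rowSumℤ r)
      ; colSum     = λ c → sumℤ≡0⇒sumᵥ≡0 (col (mapCells residue Z) c) (colSumℤ c)
      }
    ; rowSumℤ = rowSumℤ
    ; colSumℤ = colSumℤ
    }
    where
    open Heffterℤ H
    J-spec : ∃[ J ] (IsSubgroup J × ∣ J ∣ ≡ k × (∀ x → suc (2 * n) ∣ toℕ x → x ∈ J))
    J-spec = multiples-subgroup {k = k} (modulus-factors n k)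
    J : Subset v
    J = proj₁ J-spec
    isSubgroup : IsSubgroup J
    isSubgroup = proj₁ (proj₂ J-spec)
    order : ∣ J ∣ ≡ k
    order = proj₁ (proj₂ (proj₂ J-spec))
    ∈J : ∀ x → suc (2 * n) ∣ toℕ x → x ∈ J
    ∈J = proj₂ (proj₂ (proj₂ J-spec))

    rows : ∀ r → row (mapCells residue Z) r ≡ map residue (row Z r)
    rows r = mapMaybe-map residue (Z r) (allFin n)
    cols : ∀ c → col (mapCells residue Z) c ≡ map residue (col Z c)
    cols c = mapMaybe-map residue (λ r → Z r c) (allFin n)

    centred-cells : ∀ (f : Fin n → Maybe ℤ) → (∀ {i z} → f i ≡ just z → 2 * ℤ.∣ z ∣ < v) → ∀ is →
      map centred (mapMaybe (Maybe.map residue ∘ f) is) ≡ mapMaybe f is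
    centred-cells f small []       = refl
    centred-cells f small (i ∷ is) with f i in eq
    ... | nothing = centred-cells f small is
    ... | just z  = cong₂ _∷_ (centred-residue z (small eq)) (centred-cells f small is)

    rowSumℤ : ∀ r → sumℤ (map centred (row (mapCells residue Z) r)) ≡ 0ℤ
    rowSumℤ r = trans (cong sumℤ (centred-cells (Z r) strict (allFin n))) (rowZero r)
    colSumℤ : ∀ c → sumℤ (map centred (col (mapCells residue Z) c)) ≡ 0ℤ
    colSumℤ c = trans (cong sumℤ (centred-cells (λ r → Z r c) strict (allFin n))) (colZero c)

    w∣v : suc (2 * n) ∣ v
    w∣v = divides k (modulus-factors n k)

    covers : ∀ x → ¬ suc (2 * n) ∣ toℕ x → AppearsIn x (mapCells residue Z) ⊎ AppearsIn (-ᵥ x) (mapCells residue Z)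
    covers x w∤x with 2 * toℕ x ≤? v
    ... | yes 2x≤v = Sum.map
      (AppearsIn-map residue (sym (mod-toℕ x)))
      (AppearsIn-map residue (sym (trans (residue-neg (toℕ x)) (cong -ᵥ_ (mod-toℕ x)))))
      (covered (toℕ x) 2x≤v w∤x)
    -- Above v/2 the number to look up is v - x, the least residue of -x, so the two alternatives
    -- change places.
    ... | no  2x≰v = Sum.swap (Sum.map
      (AppearsIn-map residue refl)
      (AppearsIn-map residue (sym (trans (residue-neg (v ∸ toℕ x)) (neg-involutive x))))
      (covered (v ∸ toℕ x) (<⇒≤ (2[v∸y]<v (Fin.toℕ≤n x) (≰⇒> 2x≰v)))
        (λ w∣v-x → w∤x (subst (suc (2 * n) ∣_) (m∸[m∸n]≡n (Fin.toℕ≤n x)) (∣m∣n⇒∣m∸n (m∸n≤m v (toℕ x)) w∣v w∣v-x)))))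

-- Extending an integer Heffter array by layers

sumℤ-↭ : ∀ {xs ys} → xs ↭ ys → sumℤ xs ≡ sumℤ ys
sumℤ-↭ xs↭ys = ↭ₛ.foldr-commMonoid (setoid ℤ) ℤ.+-0-isCommutativeMonoid (↭⇒↭ₛ xs↭ys)

sumℤ-++ : ∀ xs ys → sumℤ (xs ++ ys) ≡ sumℤ xs ℤ.+ sumℤ ys
sumℤ-++ []       ys = sym (ℤ.+-identityˡ _)
sumℤ-++ (x ∷ xs) ys = trans (cong (ℤ._+_ x) (sumℤ-++ xs ys)) (sym (ℤ.+-assoc x _ _))

-- The share of `Heffterℤ` for k′ that new layers contribute. Up to half of the old modulus the old
-- array already covers everything; the excluded multiples of 2n + 1 are the same for k and k′.
record Completes (n k k′ : ℕ) (ls : List (Layer n)) : Set where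
  field
    enough   : k′ ≡ length ls + k
    rowZero  : ∀ r → sumℤ (map (λ l → rowVal l r) ls) ≡ 0ℤ
    colZero  : ∀ c → sumℤ (map (λ l → val l c) ls) ≡ 0ℤ
    bounded  : ∀ {l} → l ∈ˡ ls → ∀ c → 2 * ℤ.∣ val l c ∣ < modulus n k′ k′
    covered  : ∀ y → modulus n k k < 2 * y → 2 * y ≤ modulus n k′ k′ → ¬ suc (2 * n) ∣ y →
      ∃[ l ] (l ∈ˡ ls × (∃[ c ] (val l c ≡ ℤ.+ y ⊎ val l c ≡ ℤ.- ℤ.+ y)))

module Extend {n k k′ : ℕ} .{{_ : NonZero n}} .{{_ : NonZero k}} (k<k′ : k < k′)
  {A : PFArray n n (Fin (modulus n k k))} (isInteger : IsIntegerHeffter n k k A)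
  {ls : List (Layer n)} (fit : Fits (mapCells centred A) ls) (completes : Completes n k k′ ls) where

  private
    Z : PFArray n n ℤ
    Z = mapCells centred A
    instance
      k′-nonZero : NonZero k′
      k′-nonZero = >-nonZero (≤-<-trans z≤n k<k′)
      V-nonZero : NonZero (modulus n k′ k′)
      V-nonZero = modulus-nonZero n k′
  open Completes completes
  module Old = Heffterℤ (toℤ {k = k} isInteger)
  open Residue (modulus n k′ k′)

  extended : PFArray n n (Fin (modulus n k′ k′))
  extended = mapCells residue (stack ls Z)

  v<V : modulus n k k < modulus n k′ k′
  v<V = +-mono-≤-< (*-monoʳ-≤ (2 * n) (<⇒≤ k<k′)) k<k′

  private
    strict : ∀ {r c z} → stack ls Z r c ≡ just z → 2 * ℤ.∣ z ∣ < modulus n k′ k′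
    strict eq with stack-cell Z ls eq
    ... | inj₁ old = ≤-<-trans (Old.bounded old) v<V
    ... | inj₂ (l , l∈ , _ , refl) = bounded l∈ _

    covered′ : ∀ y → 2 * y ≤ modulus n k′ k′ → ¬ suc (2 * n) ∣ y → AppearsIn (ℤ.+ y) (stack ls Z) ⊎ AppearsIn (ℤ.- ℤ.+ y) (stack ls Z)
    covered′ y 2y≤V w∤y with 2 * y ≤? modulus n k k
    ... | yes 2y≤v = Sum.map keep keep (Old.covered y 2y≤v w∤y)
      where
      keep : ∀ {z} → AppearsIn z Z → AppearsIn z (stack ls Z)
      keep (r , c , eq) = r , c , stack-keeps Z ls fit eq
    ... | no  2y≰v with covered y (≰⇒> 2y≰v) 2y≤V w∤y
    ...   | l , l∈ , c , val≡ = Sum.map appears appears val≡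
      where
      appears : ∀ {z} → val l c ≡ z → AppearsIn z (stack ls Z)
      appears refl = rowOf l c , c , stack-entry Z ls fit l∈ c

    length-line : ∀ {X : Set} {xs : List ℤ} {ys} (f : X → ℤ) ms → xs ↭ map f ms ++ ys → length xs ≡ length ms + length ys
    length-line f ms xs↭ = trans (↭-length xs↭) (trans (List.length-++ (map f ms)) (cong (_+ _) (List.length-map f ms)))

    sum-line : ∀ {xs} ys zs → xs ↭ ys ++ zs → sumℤ ys ≡ 0ℤ → sumℤ zs ≡ 0ℤ → sumℤ xs ≡ 0ℤ
    sum-line ys zs xs↭ ys≡0 zs≡0 = trans (sumℤ-↭ xs↭) (trans (sumℤ-++ ys zs) (cong₂ ℤ._+_ ys≡0 zs≡0))

  extended-isInteger : IsIntegerHeffter n k′ k′ extended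
  extended-isInteger = fromℤ (>-nonZero⁻¹ n) (record
    { rowLength = λ r → trans (length-line _ ls (row-stack Z ls fit r)) (trans (cong (length ls +_) (Old.rowLength r)) (sym enough))
    ; colLength = λ c → trans (length-line _ ls (col-stack Z ls fit c)) (trans (cong (length ls +_) (Old.colLength c)) (sym enough))
    ; rowZero   = λ r → sum-line (map (λ l → rowVal l r) ls) (row Z r) (row-stack Z ls fit r) (rowZero r) (Old.rowZero r)
    ; colZero   = λ c → sum-line (map (λ l → val l c) ls) (col Z c) (col-stack Z ls fit c) (colZero c) (Old.colZero c)
    ; bounded   = λ eq → <⇒≤ (strict eq)
    ; covered   = covered′
    }) strict

  extended-cell⁻ : ∀ {r c} → Is-just (extended r c) → Is-just (A r c) ⊎ (∃[ l ] (l ∈ˡ ls × r ≡ rowOf l c))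
  extended-cell⁻ {r} {c} filled with is-just⁻ filled
  ... | x , eq with map-just⁻ residue (stack ls Z r c) eq
  ...   | z , eq′ , _ with stack-cell Z ls eq′
  ...     | inj₂ (l , l∈ , r≡ , _) = inj₂ (l , l∈ , r≡)
  ...     | inj₁ old with map-just⁻ centred (A r c) old
  ...       | a , eq″ , _ = inj₁ (is-just⁺ eq″)

  extended-old : ∀ {r c} → Is-just (A r c) → Is-just (extended r c)
  extended-old {r} {c} filled with is-just⁻ filled
  ... | a , eq = is-just⁺ (cong (Maybe.map residue) (stack-keeps Z ls fit (cong (Maybe.map centred) eq)))

  extended-new : ∀ {l} → l ∈ˡ ls → ∀ c → Is-just (extended (rowOf l c) c)
  extended-new l∈ c = is-just⁺ (cong (Maybe.map residue) (stack-entry Z ls fit l∈ c))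

-- Cyclic shifts and diagonals

-- A shift inverse to the one by t. It equals n, not 0, when n divides t; only its class modulo n
-- matters.
shiftBack : ∀ n .{{_ : NonZero n}} → ℕ → ℕ
shiftBack n t = n ∸ t % n

module _ {n : ℕ} .{{n≢0 : NonZero n}} where

  toℕ-⊕ : ∀ (c : Fin n) t → toℕ (c ⊕ t) ≡ (toℕ c + t) % n
  toℕ-⊕ c t = toℕ-mod (toℕ c + t) n {{n≢0}}

  ⊕-cong : ∀ (c d : Fin n) {s t} → toℕ c + s ≡ toℕ d + t → c ⊕ s ≡ d ⊕ t
  ⊕-cong c d {s} {t} eq = Fin.toℕ-injective (trans (toℕ-⊕ c s) (trans (cong (_% n) eq) (sym (toℕ-⊕ d t))))

  ⊕-assoc : ∀ (c : Fin n) s t → (c ⊕ s) ⊕ t ≡ c ⊕ (s + t)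
  ⊕-assoc c s t = Fin.toℕ-injective (begin
    toℕ ((c ⊕ s) ⊕ t)           ≡⟨ toℕ-⊕ (c ⊕ s) t ⟩
    (toℕ (c ⊕ s) + t) % n       ≡⟨ cong (λ z → (z + t) % n) (toℕ-⊕ c s) ⟩
    ((toℕ c + s) % n + t) % n   ≡⟨ [m%d+n]%d≡[m+n]%d (toℕ c + s) t n ⟩
    (toℕ c + s + t) % n         ≡⟨ cong (_% n) (+-assoc (toℕ c) s t) ⟩
    (toℕ c + (s + t)) % n       ≡⟨ toℕ-⊕ c (s + t) ⟨
    toℕ (c ⊕ (s + t))           ∎)
    where open ≡-Reasoning

  ⊕-comm : ∀ (c d : Fin n) → c ⊕ toℕ d ≡ d ⊕ toℕ c
  ⊕-comm c d = ⊕-cong c d (+-comm (toℕ c) (toℕ d))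

  ⊕-multiple : ∀ (c : Fin n) {t} → n ∣ t → c ⊕ t ≡ c
  ⊕-multiple c {t} n∣t = Fin.toℕ-injective (begin
    toℕ (c ⊕ t)       ≡⟨ toℕ-⊕ c t ⟩
    (toℕ c + t) % n   ≡⟨ %-remove-+ʳ (toℕ c) n∣t ⟩
    toℕ c % n         ≡⟨ m<n⇒m%n≡m (Fin.toℕ<n c) ⟩
    toℕ c             ∎)
    where open ≡-Reasoning

  ∣t+shiftBack : ∀ t → n ∣ t + shiftBack n t
  ∣t+shiftBack t = subst (n ∣_) (sym (begin
    t + (n ∸ t % n)                        ≡⟨ cong (_+ (n ∸ t % n)) (m≡m%n+[m/n]*n t n) ⟩
    (t % n + t / n * n) + (n ∸ t % n)      ≡⟨ cong (_+ (n ∸ t % n)) (+-comm (t % n) _) ⟩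
    (t / n * n + t % n) + (n ∸ t % n)      ≡⟨ +-assoc (t / n * n) (t % n) _ ⟩
    t / n * n + (t % n + (n ∸ t % n))      ≡⟨ cong (t / n * n +_) (m+[n∸m]≡n (m%n≤n t n)) ⟩
    t / n * n + n                          ∎)) (∣m∣n⇒∣m+n (n∣m*n (t / n)) ∣-refl)
    where open ≡-Reasoning

  rotation : ℕ → Permutation′ n
  rotation t = permutation (_⊕ t) (_⊕ shiftBack n t)
    (λ c → trans (⊕-assoc c (shiftBack n t) t) (⊕-multiple c (subst (n ∣_) (+-comm t (shiftBack n t)) (∣t+shiftBack t))))
    (λ c → trans (⊕-assoc c t (shiftBack n t)) (⊕-multiple c (∣t+shiftBack t)))

  rotation-injective : ∀ t {c d : Fin n} → c ⊕ t ≡ d ⊕ t → c ≡ d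
  rotation-injective t eq = trans (sym (inverseˡ (rotation t))) (trans (cong (_⊕ shiftBack n t) eq) (inverseˡ (rotation t)))

  diagonal-rotation : ∀ (i : Fin n) j (c : Fin n) → (i ⊕ j) ⊕ toℕ c ≡ c ⊕ (toℕ i + j)
  diagonal-rotation i j c = trans (⊕-assoc i j (toℕ c)) (⊕-cong i c (begin
    toℕ i + (j + toℕ c)   ≡⟨ +-assoc (toℕ i) j (toℕ c) ⟨
    toℕ i + j + toℕ c     ≡⟨ +-comm (toℕ i + j) (toℕ c) ⟩
    toℕ c + (toℕ i + j)   ∎))
    where open ≡-Reasoning

  -- An index below n is itself an element of `Fin n`, and both sides are its rotation by i + c,
  -- which is injective. Both the freeness and the disjointness of new diagonals rest on this.
  diagonal-injective : ∀ (i c : Fin n) {j j′} → j < n → j′ < n → (i ⊕ j) ⊕ toℕ c ≡ (i ⊕ j′) ⊕ toℕ c → j ≡ j′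
  diagonal-injective i c {j} {j′} j<n j′<n eq = begin
    j                       ≡⟨ Fin.toℕ-fromℕ< j<n ⟨
    toℕ (Fin.fromℕ< j<n)    ≡⟨ cong toℕ (rotation-injective (toℕ i + toℕ c) (trans (sym (swap j<n)) (trans eq (swap j′<n)))) ⟩
    toℕ (Fin.fromℕ< j′<n)   ≡⟨ Fin.toℕ-fromℕ< j′<n ⟩
    j′                      ∎
    where
    open ≡-Reasoning
    swap : ∀ {j} (j<n : j < n) → (i ⊕ j) ⊕ toℕ c ≡ Fin.fromℕ< j<n ⊕ (toℕ i + toℕ c)
    swap {j} j<n = trans (⊕-assoc i j (toℕ c)) (⊕-cong i (Fin.fromℕ< j<n) (begin
      toℕ i + (j + toℕ c)                          ≡⟨ +-assoc (toℕ i) j (toℕ c) ⟨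
      toℕ i + j + toℕ c                            ≡⟨ cong (_+ toℕ c) (+-comm (toℕ i) j) ⟩
      j + toℕ i + toℕ c                            ≡⟨ +-assoc j (toℕ i) (toℕ c) ⟩
      j + (toℕ i + toℕ c)                          ≡⟨ cong (_+ (toℕ i + toℕ c)) (Fin.toℕ-fromℕ< j<n) ⟨
      toℕ (Fin.fromℕ< j<n) + (toℕ i + toℕ c)       ∎))

toℕ+opposite : ∀ {n} (c : Fin n) → suc (toℕ c + toℕ (opposite c)) ≡ n
toℕ+opposite c = trans (cong (λ z → suc (toℕ c) + z) (Fin.opposite-prop c)) (m+[n∸m]≡n (Fin.toℕ<n c))

-- Four new diagonals filled from four intervals

_∈[_,+_⟩ : ℕ → ℕ → ℕ → Set
y ∈[ b ,+ m ⟩ = b ≤ y × y < b + m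

offset : ∀ {y b m} → y ∈[ b ,+ m ⟩ → ∃[ c ] y ≡ b + toℕ {m} c
offset {y} {b} {m} (b≤y , y<b+m) = Fin.fromℕ< {y ∸ b} y-b<m , (begin
  y                                    ≡⟨ m+[n∸m]≡n b≤y ⟨
  b + (y ∸ b)                          ≡⟨ cong (b +_) (Fin.toℕ-fromℕ< y-b<m) ⟨
  b + toℕ (Fin.fromℕ< {y ∸ b} y-b<m)   ∎)
  where
  open ≡-Reasoning
  y-b<m : y ∸ b < m
  y-b<m = +-cancelˡ-< b _ _ (subst (_< b + m) (sym (m+[n∸m]≡n b≤y)) y<b+m)

balanced : ∀ a b c d → a + b ≡ c + d → sumℤ (ℤ.+ a ∷ ℤ.+ b ∷ (ℤ.- ℤ.+ c) ∷ (ℤ.- ℤ.+ d) ∷ []) ≡ 0ℤ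
balanced a b c d eq = begin
  ℤ.+ a ℤ.+ (ℤ.+ b ℤ.+ ((ℤ.- ℤ.+ c) ℤ.+ ((ℤ.- ℤ.+ d) ℤ.+ 0ℤ)))   ≡⟨ ring (ℤ.+ a) (ℤ.+ b) (ℤ.+ c) (ℤ.+ d) ⟩
  ℤ.+ (a + b) ℤ.- ℤ.+ (c + d)                                     ≡⟨ cong (λ z → ℤ.+ z ℤ.- ℤ.+ (c + d)) eq ⟩
  ℤ.+ (c + d) ℤ.- ℤ.+ (c + d)                                     ≡⟨ ℤ.+-inverseʳ (ℤ.+ (c + d)) ⟩
  0ℤ                                                              ∎
  where
  open ≡-Reasoning
  ring : ∀ a b c d → a ℤ.+ (b ℤ.+ ((ℤ.- c) ℤ.+ ((ℤ.- d) ℤ.+ 0ℤ))) ≡ (a ℤ.+ b) ℤ.- (c ℤ.+ d)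
  ring = ℤSolver.solve-∀

-- The absolute values in the four new diagonals of part (1) fill the intervals [bⱼ, bⱼ + n).
record FourIntervals (n k : ℕ) : Set where
  field
    b₀ b₁ b₂ b₃ : ℕ
    balance : b₀ + b₁ ≡ b₂ + b₃
    small   : ∀ y → (y ∈[ b₀ ,+ n ⟩ ⊎ y ∈[ b₁ ,+ n ⟩) ⊎ (y ∈[ b₂ ,+ n ⟩ ⊎ y ∈[ b₃ ,+ n ⟩) → 2 * y < modulus n (k + 4) (k + 4)
    fill    : ∀ y → modulus n k k < 2 * y → 2 * y ≤ modulus n (k + 4) (k + 4) → ¬ suc (2 * n) ∣ y →
      (y ∈[ b₀ ,+ n ⟩ ⊎ y ∈[ b₁ ,+ n ⟩) ⊎ (y ∈[ b₂ ,+ n ⟩ ⊎ y ∈[ b₃ ,+ n ⟩)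

∈-offset : ∀ {m} b (c : Fin m) → (b + toℕ c) ∈[ b ,+ m ⟩
∈-offset b c = m≤m+n b (toℕ c) , +-monoʳ-< b (Fin.toℕ<n c)

module AddDiagonals {n k : ℕ} .{{_ : NonZero n}} .{{_ : NonZero k}} (bases : FourIntervals n k)
  {A : PFArray n n (Fin (modulus n k k))} (isInteger : IsIntegerHeffter n k k A) (diagonal : CyclicallyDiagonal k A)
  (k+4≤n : k + 4 ≤ n) where

  open FourIntervals bases

  i : Fin n
  i = proj₁ (proj₂ diagonal)

  filled : ∀ r c → Is-just (A r c) ⇔ (∃[ j ] (j < k × OnDiagonal (i ⊕ j) r c))
  filled = proj₂ (proj₂ diagonal)

  value : Fin 4 → Fin n → ℤ
  value 0F c = ℤ.+ (b₀ + toℕ c)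
  value 1F c = ℤ.+ (b₁ + toℕ (opposite c))
  value 2F c = ℤ.- ℤ.+ (b₂ + toℕ (c ⊕ 2))
  value 3F c = ℤ.- ℤ.+ (b₃ + toℕ (opposite (c ⊕ 2)))

  layer : Fin 4 → Layer n
  layer t = record { cells = rotation (toℕ i + (k + toℕ t)) ; val = value t }

  layer-diagonal : ∀ t c → rowOf (layer t) c ≡ (i ⊕ (k + toℕ t)) ⊕ toℕ c
  layer-diagonal t c = sym (diagonal-rotation i (k + toℕ t) c)

  k+t<k+4 : ∀ (t : Fin 4) → k + toℕ t < k + 4
  k+t<k+4 t = +-monoʳ-< k (Fin.toℕ<n t)

  k+t<n : ∀ (t : Fin 4) → k + toℕ t < n
  k+t<n t = <-≤-trans (k+t<k+4 t) k+4≤n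

  -- Because k + 4 ≤ n, old and new diagonal indices are distinct numbers below n, and such
  -- diagonals share no cell.
  fit : Fits (mapCells centred A) (tabulate layer)
  fit = fits (All.tabulate⁺ {f = layer} free) (AllPairs.tabulate⁺ {f = layer} apart)
    where
    free : ∀ t → Free (mapCells centred A) (layer t)
    free t c = cong (Maybe.map centred) (not-just λ occupied → case Equivalence.to (filled _ c) occupied of λ where
      (j , j<k , r≡) → <⇒≢ (<-≤-trans j<k (m≤m+n k (toℕ t)))
        (diagonal-injective i c (<-trans (<-≤-trans j<k (m≤m+n k (toℕ t))) (k+t<n t)) (k+t<n t)
          (trans (sym r≡) (layer-diagonal t c))))
    apart : ∀ {s t} → s ≢ t → Apart (layer s) (layer t)
    apart {s} {t} s≢t c eq = s≢t (Fin.toℕ-injective (+-cancelˡ-≡ k _ _ (diagonal-injective i c (k+t<n s) (k+t<n t)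
      (trans (sym (layer-diagonal s c)) (trans eq (layer-diagonal t c))))))

  -- The row r meets layer t + 2 two columns before it meets layer t, which the shift in `value` undoes.
  colOf-shift : ∀ s t → toℕ t ≡ toℕ s + 2 → ∀ r → colOf (layer t) r ⊕ 2 ≡ colOf (layer s) r
  colOf-shift s t t≡s+2 r = begin
    c ⊕ 2                                      ≡⟨ inverseˡ (cells (layer s)) ⟨
    colOf (layer s) (rowOf (layer s) (c ⊕ 2))  ≡⟨ cong (colOf (layer s)) (trans (⊕-assoc c 2 _) (cong (c ⊕_) shift)) ⟩
    colOf (layer s) (rowOf (layer t) c)        ≡⟨ cong (colOf (layer s)) (inverseʳ (cells (layer t))) ⟩
    colOf (layer s) r                          ∎
    where
    open ≡-Reasoning
    c : Fin n
    c = colOf (layer t) r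
    ring : ∀ i k s → 2 + (i + (k + s)) ≡ i + (k + (s + 2))
    ring = ℕSolver.solve-∀
    shift : 2 + (toℕ i + (k + toℕ s)) ≡ toℕ i + (k + toℕ t)
    shift = trans (ring (toℕ i) k (toℕ s)) (cong (λ z → toℕ i + (k + z)) (sym t≡s+2))

  sum-zero : ∀ p q p′ q′ → p + q ≡ p′ + q′ →
    sumℤ (ℤ.+ (b₀ + p) ∷ ℤ.+ (b₁ + q) ∷ (ℤ.- ℤ.+ (b₂ + p′)) ∷ (ℤ.- ℤ.+ (b₃ + q′)) ∷ []) ≡ 0ℤ
  sum-zero p q p′ q′ eq = balanced (b₀ + p) (b₁ + q) (b₂ + p′) (b₃ + q′)
    (trans (ring b₀ b₁ p q) (trans (cong₂ _+_ balance eq) (sym (ring b₂ b₃ p′ q′))))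
    where
    ring : ∀ a b p q → (a + p) + (b + q) ≡ (a + b) + (p + q)
    ring = ℕSolver.solve-∀

  completes : Completes n k (k + 4) (tabulate layer)
  completes = record
    { enough  = +-comm k 4
    ; rowZero = λ r → sum-zero (toℕ (colOf (layer 0F) r)) (toℕ (opposite (colOf (layer 1F) r)))
        (toℕ (colOf (layer 2F) r ⊕ 2)) (toℕ (opposite (colOf (layer 3F) r ⊕ 2)))
        -- In a row, layers 0 and 2 carry the same offset, and so do layers 1 and 3.
        (cong₂ (λ c d → toℕ c + toℕ (opposite d)) (sym (colOf-shift 0F 2F refl r)) (sym (colOf-shift 1F 3F refl r)))
    ; colZero = λ c → sum-zero (toℕ c) (toℕ (opposite c)) (toℕ (c ⊕ 2)) (toℕ (opposite (c ⊕ 2)))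
        -- In a column the offsets of an increasing and a decreasing layer add up to n - 1,
        -- whichever column they are read at.
        (suc-injective (trans (toℕ+opposite c) (sym (toℕ+opposite (c ⊕ 2)))))
    ; bounded = λ l∈ c → case ∈-tabulate⁻ {f = layer} l∈ of λ where (t , refl) → bounded t c
    ; covered = λ y v<2y 2y≤V w∤y → case covered y (fill y v<2y 2y≤V w∤y) of λ where
        (t , c , eq) → layer t , ∈-tabulate⁺ {f = layer} t , c , eq
    }
    where
    bounded : ∀ t c → 2 * ℤ.∣ value t c ∣ < modulus n (k + 4) (k + 4)
    bounded 0F c = small _ (inj₁ (inj₁ (∈-offset b₀ c)))
    bounded 1F c = small _ (inj₁ (inj₂ (∈-offset b₁ (opposite c))))
    bounded 2F c = subst (λ z → 2 * z < modulus n (k + 4) (k + 4)) (sym (ℤ.∣-i∣≡∣i∣ (ℤ.+ (b₂ + toℕ (c ⊕ 2))))) (small _ (inj₂ (inj₁ (∈-offset b₂ (c ⊕ 2)))))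
    bounded 3F c = subst (λ z → 2 * z < modulus n (k + 4) (k + 4)) (sym (ℤ.∣-i∣≡∣i∣ (ℤ.+ (b₃ + toℕ (opposite (c ⊕ 2)))))) (small _ (inj₂ (inj₂ (∈-offset b₃ (opposite (c ⊕ 2))))))

    covered : ∀ y → (y ∈[ b₀ ,+ n ⟩ ⊎ y ∈[ b₁ ,+ n ⟩) ⊎ (y ∈[ b₂ ,+ n ⟩ ⊎ y ∈[ b₃ ,+ n ⟩) →
      ∃[ t ] ∃[ c ] (value t c ≡ ℤ.+ y ⊎ value t c ≡ ℤ.- ℤ.+ y)
    covered y (inj₁ (inj₁ y∈)) with offset y∈
    ... | c , refl = 0F , c , inj₁ refl
    covered y (inj₁ (inj₂ y∈)) with offset y∈
    ... | c , refl = 1F , opposite c , inj₁ (cong (λ d → ℤ.+ (b₁ + toℕ d)) (Fin.opposite-involutive c))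
    covered y (inj₂ (inj₁ y∈)) with offset y∈
    -- The witness undoes the shift by two columns built into `value`.
    ... | c , refl = 2F , c ⊕ shiftBack n 2 , inj₂ (cong (λ d → ℤ.- ℤ.+ (b₂ + toℕ d)) (inverseʳ (rotation 2)))
    covered y (inj₂ (inj₂ y∈)) with offset y∈
    ... | c , refl = 3F , opposite c ⊕ shiftBack n 2 , inj₂ (cong (λ d → ℤ.- ℤ.+ (b₃ + toℕ d))
      (trans (cong opposite (inverseʳ (rotation 2))) (Fin.opposite-involutive c)))

  open Extend (m<m+n k (z<s {3})) isInteger fit completes

  extended-diagonal : CyclicallyDiagonal (k + 4) extended
  extended-diagonal = k+4≤n , i , λ r c → mk⇔ (to r c) (from r c)
    where
    to : ∀ r c → Is-just (extended r c) → ∃[ j ] (j < k + 4 × OnDiagonal (i ⊕ j) r c)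
    to r c occupied with extended-cell⁻ occupied
    ... | inj₁ old with Equivalence.to (filled r c) old
    ...   | j , j<k , r≡ = j , <-≤-trans j<k (m≤m+n k 4) , r≡
    to r c occupied | inj₂ (l , l∈ , r≡) with ∈-tabulate⁻ {f = layer} l∈
    ...   | t , refl = k + toℕ t , k+t<k+4 t , trans r≡ (layer-diagonal t c)

    from : ∀ r c → (∃[ j ] (j < k + 4 × OnDiagonal (i ⊕ j) r c)) → Is-just (extended r c)
    from r c (j , j<k+4 , r≡) with j <? k
    ... | yes j<k = extended-old (Equivalence.from (filled r c) (j , j<k , r≡))
    ... | no  j≮k with offset {j} {k} {4} (≮⇒≥ j≮k , j<k+4)
    ...   | t , refl = subst (λ r → Is-just (extended r c)) (sym (trans r≡ (sym (layer-diagonal t c)))) (extended-new (∈-tabulate⁺ {f = layer} t) c)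

  extension : ∃[ A′ ] (IsIntegerHeffter n (k + 4) (k + 4) A′ × CyclicallyDiagonal (k + 4) A′)
  extension = extended , extended-isInteger , extended-diagonal

-- Block diagonals

-- The simply transitive action of ℤ/2 on `Fin 2`. In a 2 × 2 block the cells `(flip s b , b)` form
-- the main diagonal for s = 0 and the antidiagonal for s = 1, so s tells apart the two layers of a
-- block diagonal.
flip : Fin 2 → Fin 2 → Fin 2
flip 0F a = a
flip 1F a = opposite a

flip-involutive : ∀ s a → flip s (flip s a) ≡ a
flip-involutive 0F a = refl
flip-involutive 1F a = Fin.opposite-involutive a

flip-injective : ∀ s t a → flip s a ≡ flip t a → s ≡ t
flip-injective 0F 0F a  _ = refl
flip-injective 1F 1F a  _ = refl
flip-injective 0F 1F 0F ()
flip-injective 0F 1F 1F ()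
flip-injective 1F 0F 0F ()
flip-injective 1F 0F 1F ()

flip-transitive : ∀ a b → ∃[ s ] flip s b ≡ a
flip-transitive 0F 0F = 0F , refl
flip-transitive 0F 1F = 1F , refl
flip-transitive 1F 0F = 1F , refl
flip-transitive 1F 1F = 0F , refl

signed : Sign → ℤ → ℤ
signed Sign.+ z = z
signed Sign.- z = ℤ.- z

∣signed∣ : ∀ s z → ℤ.∣ signed s z ∣ ≡ ℤ.∣ z ∣
∣signed∣ Sign.+ z = refl
∣signed∣ Sign.- z = ℤ.∣-i∣≡∣i∣ z

signed-± : ∀ s z → signed s z ≡ z ⊎ signed s z ≡ ℤ.- z
signed-± Sign.+ z = inj₁ refl
signed-± Sign.- z = inj₂ refl

-- The signs of the block (x, -(x + g); -(x + 2g), x + 3g), whose row sums are -g, g and whose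
-- column sums are -2g, 2g.
chequer : Fin 2 → Fin 2 → Sign
chequer 0F 0F = Sign.+
chequer 0F 1F = Sign.-
chequer 1F 0F = Sign.-
chequer 1F 1F = Sign.+

record Blocks (m N : ℕ) : Set where
  field
    sgn  : Fin m → Sign
    gap  : Fin m → ℕ
    base : Fin m → Fin N → ℕ

  size : Fin m → Fin N → Fin 2 → Fin 2 → ℕ
  size u J a b = base u J + gap u * toℕ (combine a b)

  entry : Fin m → Fin N → Fin 2 → Fin 2 → ℤ
  entry u J a b = signed (sgn u Sign.* chequer a b) (ℤ.+ size u J a b)

-- Blocks are indexed by their block column. A column therefore meets all m diagonals at the same J,
-- whereas a row meets them at different ones; allowing arbitrary `Js` avoids computing which.
record BlockFilling (m N k k′ : ℕ) : Set where
  field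
    blocks : Blocks m N
  open Blocks blocks public
  n : ℕ
  n = N * 2
  field
    enough : k′ ≡ m * 2 + k
    rowSum : ∀ (Js : Fin m → Fin N) a →
      sumℤ (tabulate {n = m * 2} λ x → let (u , s) = remQuot {m} 2 x in entry u (Js u) a (flip s a)) ≡ 0ℤ
    colSum : ∀ J b →
      sumℤ (tabulate {n = m * 2} λ x → let (u , s) = remQuot {m} 2 x in entry u J (flip s b) b) ≡ 0ℤ
    small  : ∀ u J a b → 2 * size u J a b < modulus n k′ k′
    fill   : ∀ y → modulus n k k < 2 * y → 2 * y ≤ modulus n k′ k′ → ¬ suc (2 * n) ∣ y →
      ∃[ u ] ∃[ J ] ∃[ a ] ∃[ b ] y ≡ size u J a b

module AddBlockDiagonals {m N k k′ d : ℕ} .{{_ : NonZero (N * 2)}} .{{_ : NonZero k}} (k<k′ : k < k′) (bases : BlockFilling m N k k′)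
  {S : PFArray (N * 2) (N * 2) (Fin (modulus (N * 2) k k))} (isInteger : IsIntegerHeffter (N * 2) k k S)
  (A : PFArray N N ⊤) (diagonal : CyclicallyDiagonal d A) (B : Fin N → Fin N → PFArray 2 2 (Fin (modulus (N * 2) k k)))
  (B-empty : ∀ I J → A I J ≡ nothing → ∀ a b → B I J a b ≡ nothing) (shift : Fin (N * 2))
  (columns : ∀ r c → S r c ≡ assemble B (cast refl r) (cast refl (shift ⊕ toℕ c)))
  (d+m≤N : d + m ≤ N) where

  open BlockFilling bases

  i : Fin N
  i = proj₁ (proj₂ diagonal)

  instance
    N-nonZero : NonZero N
    N-nonZero = Fin.nonZeroIndex i

  -- `cast refl` is kept so that these coordinates are definitionally those of `assemble`, and
  -- `columns` applies without transport.
  rowIndex : Fin n ↔ (Fin N × Fin 2)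
  rowIndex = mk↔ₛ′ (λ r → remQuot 2 (cast refl r)) (uncurry combine)
    (λ (I , a) → trans (cong (remQuot 2) (Fin.cast-is-id refl (combine I a))) (Fin.remQuot-combine I a))
    (λ r → trans (Fin.combine-remQuot {N} 2 (cast refl r)) (Fin.cast-is-id refl r))

  -- The column rotation of the block array is absorbed here, so layers can be laid out as if the
  -- columns had not been shifted.
  colIndex : Fin n ↔ (Fin N × Fin 2)
  colIndex = rowIndex ↔-∘ mk↔ₛ′ (λ c → shift ⊕ toℕ c) (_⊕ shiftBack n (toℕ shift))
    (λ c → trans (⊕-comm shift _) (inverseʳ (rotation (toℕ shift))))
    (λ c → trans (cong (_⊕ shiftBack n (toℕ shift)) (⊕-comm shift c)) (inverseˡ (rotation (toℕ shift))))

  module R = Inverse rowIndex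
  module C = Inverse colIndex

  moveBlock : ℕ → Fin 2 → (Fin N × Fin 2) ↔ (Fin N × Fin 2)
  moveBlock t s = mk↔ₛ′ (λ (J , b) → J ⊕ t , flip s b) (λ (I , a) → I ⊕ shiftBack N t , flip s a)
    (λ (I , a) → cong₂ _,_ (inverseʳ (rotation t)) (flip-involutive s a))
    (λ (J , b) → cong₂ _,_ (inverseˡ (rotation t)) (flip-involutive s b))

  diagonalIndex : Fin m → ℕ
  diagonalIndex u = toℕ i + (d + toℕ u)

  layer : Fin m × Fin 2 → Layer n
  layer (u , s) = record
    { cells = ↔-sym rowIndex ↔-∘ (moveBlock (diagonalIndex u) s ↔-∘ colIndex)
    ; val   = λ c → let (J , b) = C.to c in entry u J (flip s b) b
    }

  layers : List (Layer n)
  layers = tabulate (λ x → layer (remQuot {m} 2 x))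

  layers⁺ : ∀ us → layer us ∈ˡ layers
  layers⁺ (u , s) = subst (λ us → layer us ∈ˡ layers) (Fin.remQuot-combine u s) (∈-tabulate⁺ {f = λ x → layer (remQuot {m} 2 x)} (combine u s))

  layers⁻ : ∀ {l} → l ∈ˡ layers → ∃[ us ] l ≡ layer us
  layers⁻ l∈ with ∈-tabulate⁻ {f = λ x → layer (remQuot {m} 2 x)} l∈
  ... | x , eq = remQuot {m} 2 x , eq

  layer-rowIndex : ∀ u s c → R.to (rowOf (layer (u , s)) c) ≡ (proj₁ (C.to c) ⊕ diagonalIndex u , flip s (proj₂ (C.to c)))
  layer-rowIndex u s c = R.strictlyInverseˡ _

  layer-diagonal : ∀ u s c → proj₁ (R.to (rowOf (layer (u , s)) c)) ≡ (i ⊕ (d + toℕ u)) ⊕ toℕ (proj₁ (C.to c))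
  layer-diagonal u s c = trans (cong proj₁ (layer-rowIndex u s c)) (sym (diagonal-rotation i (d + toℕ u) (proj₁ (C.to c))))

  -- In block row I at position a, the cell of the layer sits at column position `flip s a`;
  -- flipping again returns a.
  layer-rowVal : ∀ u s r → rowVal (layer (u , s)) r ≡
    entry u (proj₁ (R.to r) ⊕ shiftBack N (diagonalIndex u)) (proj₂ (R.to r)) (flip s (proj₂ (R.to r)))
  layer-rowVal u s r = trans (cong (λ (J , b) → entry u J (flip s b) b) (C.strictlyInverseˡ _))
    (cong (λ a → entry u (proj₁ (R.to r) ⊕ shiftBack N (diagonalIndex u)) a (flip s (proj₂ (R.to r)))) (flip-involutive s (proj₂ (R.to r))))

  old-block : ∀ r c → Is-just (S r c) → ∃[ j ] (j < d × OnDiagonal (i ⊕ j) (proj₁ (R.to r)) (proj₁ (C.to c)))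
  old-block r c occupied with A (proj₁ (R.to r)) (proj₁ (C.to c)) in A≡
  ... | just tt = Equivalence.to (proj₂ (proj₂ diagonal) _ _) (is-just⁺ A≡)
  ... | nothing with is-just⁻ occupied
  ...   | x , eq with () ← trans (sym eq) (trans (columns r c) (B-empty _ _ A≡ _ _))

  d+u<N : ∀ (u : Fin m) → d + toℕ u < N
  d+u<N u = <-≤-trans (+-monoʳ-< d (Fin.toℕ<n u)) d+m≤N

  fit : Fits (mapCells centred S) layers
  fit = fits (All.tabulate⁺ {f = λ x → layer (remQuot {m} 2 x)} (λ x → free (remQuot {m} 2 x)))
    (AllPairs.tabulate⁺ {f = λ x → layer (remQuot {m} 2 x)} λ {x} {y} x≢y c eq → x≢y (begin
      x                                    ≡⟨ Fin.combine-remQuot {m} 2 x ⟨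
      uncurry combine (remQuot {m} 2 x)    ≡⟨ cong (uncurry combine) (apart (remQuot {m} 2 x) (remQuot {m} 2 y) c eq) ⟩
      uncurry combine (remQuot {m} 2 y)    ≡⟨ Fin.combine-remQuot {m} 2 y ⟩
      y                                    ∎))
    where
    open ≡-Reasoning
    free : ∀ us → Free (mapCells centred S) (layer us)
    free (u , s) c = cong (Maybe.map centred) (not-just λ occupied → case old-block _ c occupied of λ where
      (j , j<d , I≡) → <⇒≢ (<-≤-trans j<d (m≤m+n d (toℕ u)))
        (diagonal-injective i (proj₁ (C.to c)) (<-trans (<-≤-trans j<d (m≤m+n d (toℕ u))) (d+u<N u)) (d+u<N u)
          (trans (sym I≡) (layer-diagonal u s c))))
    apart : ∀ us vt c → rowOf (layer us) c ≡ rowOf (layer vt) c → us ≡ vt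
    apart (u , s) (v , t) c eq = cong₂ _,_
      (Fin.toℕ-injective (+-cancelˡ-≡ d _ _ (diagonal-injective i (proj₁ (C.to c)) (d+u<N u) (d+u<N v)
        (trans (sym (layer-diagonal u s c)) (trans (cong (proj₁ ∘ R.to) eq) (layer-diagonal v t c))))))
      (flip-injective s t (proj₂ (C.to c))
        (trans (sym (cong proj₂ (layer-rowIndex u s c))) (trans (cong (proj₂ ∘ R.to) eq) (cong proj₂ (layer-rowIndex v t c)))))

  ∣entry∣ : ∀ u J a b → ℤ.∣ entry u J a b ∣ ≡ size u J a b
  ∣entry∣ u J a b = ∣signed∣ (sgn u Sign.* chequer a b) (ℤ.+ size u J a b)

  completes : Completes n k k′ layers
  completes = record
    { enough  = trans enough (cong (_+ k) (sym (List.length-tabulate (λ x → layer (remQuot {m} 2 x)))))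
    ; rowZero = λ r → trans
        (cong sumℤ (trans (List.map-tabulate (λ x → layer (remQuot {m} 2 x)) (λ l → rowVal l r)) (List.tabulate-cong λ x → layer-rowVal (proj₁ (remQuot {m} 2 x)) (proj₂ (remQuot {m} 2 x)) r)))
        (rowSum (λ u → proj₁ (R.to r) ⊕ shiftBack N (diagonalIndex u)) (proj₂ (R.to r)))
    ; colZero = λ c → trans
        (cong sumℤ (List.map-tabulate (λ x → layer (remQuot {m} 2 x)) (λ l → val l c)))
        (colSum (proj₁ (C.to c)) (proj₂ (C.to c)))
    ; bounded = λ l∈ c → case layers⁻ l∈ of λ where
        ((u , s) , refl) → bounded u (proj₁ (C.to c)) (flip s (proj₂ (C.to c))) (proj₂ (C.to c))
    ; covered = λ y v<2y 2y≤V w∤y → case fill y v<2y 2y≤V w∤y of λ where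
        (u , J , a , b , refl) → covered u J a b
    }
    where
    bounded : ∀ u J a b → 2 * ℤ.∣ entry u J a b ∣ < modulus n k′ k′
    bounded u J a b = subst (λ z → 2 * z < modulus n k′ k′) (sym (∣entry∣ u J a b)) (small u J a b)
    covered : ∀ u J a b → ∃[ l ] (l ∈ˡ layers × (∃[ c ] (val l c ≡ ℤ.+ size u J a b ⊎ val l c ≡ ℤ.- ℤ.+ size u J a b)))
    covered u J a b with flip-transitive a b
    ... | s , refl = layer (u , s) , layers⁺ (u , s) , C.from (J , b) ,
      Sum.map (trans val≡) (trans val≡) (signed-± (sgn u Sign.* chequer (flip s b) b) (ℤ.+ size u J (flip s b) b))
      where
      val≡ : val (layer (u , s)) (C.from (J , b)) ≡ entry u J (flip s b) b
      val≡ = cong (λ (J , b) → entry u J (flip s b) b) (C.strictlyInverseˡ (J , b))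

  open Extend k<k′ isInteger fit completes

  newBlock : ∀ r c → Is-just (extended r c) → ∃[ j ] (j < d + m × OnDiagonal (i ⊕ j) (proj₁ (R.to r)) (proj₁ (C.to c)))
  newBlock r c occupied with extended-cell⁻ occupied
  ... | inj₁ old with old-block r c old
  ...   | j , j<d , I≡ = j , <-≤-trans j<d (m≤m+n d m) , I≡
  newBlock r c occupied | inj₂ (l , l∈ , r≡) with layers⁻ l∈
  ...   | (u , s) , refl = d + toℕ u , +-monoʳ-< d (Fin.toℕ<n u) , trans (cong (proj₁ ∘ R.to) r≡) (layer-diagonal u s c)

  OnNewDiagonals : Fin N → Fin N → Set
  OnNewDiagonals I J = ∃[ j ] (j < d + m × OnDiagonal (i ⊕ j) I J)

  onNewDiagonals? : ∀ I J → Dec (OnNewDiagonals I J)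
  onNewDiagonals? I J = anyUpTo? (λ j → I Fin.≟ (i ⊕ j) ⊕ toℕ J) (d + m)

  -- Every cell of the d + m diagonals is marked outright. Since blocks only have to be empty off
  -- the skeleton, the single inclusion `newBlock` is all that the extended array must supply.
  skeleton : PFArray N N ⊤
  skeleton I J = if does (onNewDiagonals? I J) then just tt else nothing

  skeleton-diagonal : ∀ I J → Is-just (skeleton I J) ⇔ OnNewDiagonals I J
  skeleton-diagonal I J with onNewDiagonals? I J
  ... | yes on = mk⇔ (λ _ → on) (λ _ → just tt)
  ... | no ¬on = mk⇔ (λ ()) (λ on → contradiction on ¬on)

  extended-blocks : CyclicallyBlockDiagonal 2 (d + m) extended
  extended-blocks = record
    { N          = N
    ; A          = skeleton
    ; A-diagonal = d+m≤N , i , skeleton-diagonal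
    ; B          = λ I J a b → extended (R.from (I , a)) (C.from (J , b))
    ; B-empty    = λ I J A≡ a b → not-just λ occupied → case newBlock _ _ occupied of λ where
        (j , j<d+m , I≡) → case trans (sym A≡) (proj₂ (is-just⁻ (Equivalence.from (skeleton-diagonal I J) (j , j<d+m ,
          (subst₂ (OnDiagonal (i ⊕ j)) (cong proj₁ (R.strictlyInverseˡ (I , a))) (cong proj₁ (C.strictlyInverseˡ (J , b))) I≡))))) of λ ()
    ; size       = refl
    ; shift      = shift
    ; columns    = λ r c → sym (cong₂ extended (R.strictlyInverseʳ r) (C.strictlyInverseʳ c))
    }

  extension : ∃[ S′ ] (IsIntegerHeffter n k′ k′ S′ × CyclicallyBlockDiagonal 2 (d + m) S′)
  extension = extended , extended-isInteger , extended-blocks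

-- Intervals of non-multiples of w

-- The summands 0 and 1 are the two values of ε in the form ε + 2 κ used below.
halve : ∀ k → ∃[ κ ] (k ≡ 0 + 2 * κ ⊎ k ≡ 1 + 2 * κ)
halve zero    = 0 , inj₁ refl
halve (suc k) with halve k
... | κ , inj₁ eq = κ , inj₂ (cong suc eq)
... | κ , inj₂ eq = suc κ , inj₁ (trans (cong suc eq) (sym (*-suc 2 κ)))

-- h is half the old modulus, rounded down.  The absolute values to be placed are
-- h + 1, …, h + μ w without the multiples of w.
module Range (n κ ε μ : ℕ) (ε≤1 : ε ≤ 1) {k k′ : ℕ} (k≡ : k ≡ ε + 2 * κ) (k′≡ : k′ ≡ 2 * μ + k) where

  w h : ℕ
  w = suc (2 * n)
  h = κ * w + ε * n

  old-modulus : modulus n k k ≡ 2 * h + ε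
  old-modulus = trans (cong (λ k → modulus n k k) k≡) (ring n κ ε)
    where
    ring : ∀ n κ ε → 2 * n * (ε + 2 * κ) + (ε + 2 * κ) ≡ 2 * (κ * (1 + 2 * n) + ε * n) + ε
    ring = ℕSolver.solve-∀

  new-modulus : modulus n k′ k′ ≡ 2 * (h + μ * w) + ε
  new-modulus = trans (cong (λ k → modulus n k k) (trans k′≡ (cong (2 * μ +_) k≡))) (ring n κ ε μ)
    where
    ring : ∀ n κ ε μ → 2 * n * (2 * μ + (ε + 2 * κ)) + (2 * μ + (ε + 2 * κ)) ≡ 2 * ((κ * (1 + 2 * n) + ε * n) + μ * (1 + 2 * n)) + ε
    ring = ℕSolver.solve-∀

  above : ∀ {y} → modulus n k k < 2 * y → suc h ≤ y
  above {y} v<2y = *-cancelˡ-< 2 h y (≤-<-trans (m≤m+n (2 * h) ε) (subst (_< 2 * y) old-modulus v<2y))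

  2[1+m]≡ : ∀ m → 2 * suc m ≡ suc (2 * m + 1)
  2[1+m]≡ = ℕSolver.solve-∀

  below : ∀ {y} → 2 * y ≤ modulus n k′ k′ → y < suc (h + μ * w)
  below {y} 2y≤V = *-cancelˡ-< 2 y (suc (h + μ * w)) (begin-strict
    2 * y                      ≤⟨ 2y≤V ⟩
    modulus n k′ k′            ≡⟨ new-modulus ⟩
    2 * (h + μ * w) + ε        ≤⟨ +-monoʳ-≤ (2 * (h + μ * w)) ε≤1 ⟩
    2 * (h + μ * w) + 1        <⟨ n<1+n _ ⟩
    suc (2 * (h + μ * w) + 1)  ≡⟨ 2[1+m]≡ (h + μ * w) ⟨
    2 * suc (h + μ * w)        ∎)
    where open ≤-Reasoning

  fits-modulus : ∀ {y} → y < h + μ * w + ε → 2 * y < modulus n k′ k′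
  fits-modulus {y} y< = +-cancelʳ-< 1 _ _ (begin-strict
    2 * y + 1                       <⟨ n<1+n _ ⟩
    suc (2 * y + 1)                 ≡⟨ 2[1+m]≡ y ⟨
    2 * suc y                       ≤⟨ *-monoʳ-≤ 2 y< ⟩
    2 * (h + μ * w + ε)             ≡⟨ ring (h + μ * w) ε ⟩
    2 * (h + μ * w) + ε + ε         ≤⟨ +-monoʳ-≤ (2 * (h + μ * w) + ε) ε≤1 ⟩
    2 * (h + μ * w) + ε + 1         ≡⟨ cong (_+ 1) new-modulus ⟨
    modulus n k′ k′ + 1             ∎)
    where
    open ≤-Reasoning
    ring : ∀ a e → 2 * (a + e) ≡ 2 * a + e + e
    ring = ℕSolver.solve-∀

-- With `skip` this drives every `fill`: y is pushed up the range, past an interval by `cut` and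
-- past a multiple of w by `skip`, until it leaves the range.
cut : ∀ {y b} m → b ≤ y → y ∈[ b ,+ m ⟩ ⊎ b + m ≤ y
cut {y} {b} m b≤y = Sum.map₁ (b≤y ,_) (<-≤-connex y (b + m))

skip : ∀ {w y b} q → ¬ w ∣ y → b ≡ q * w → b ≤ y → suc b ≤ y
skip q w∤y b≡ b≤y = ≤∧≢⇒< b≤y λ where refl → w∤y (divides q b≡)

-- Here h = κ w, so the range consists of two full runs of 2n numbers, each followed by a multiple
-- of w. Halving the runs gives b₀, b₂, b₃, b₁ in increasing order, symmetric about (κ + 1) w.
fourIntervals-even : ∀ n κ {k} → k ≡ 0 + 2 * κ → FourIntervals n k
fourIntervals-even n κ {k} k≡ = record
  { b₀ = b₀ ; b₁ = b₁ ; b₂ = b₂ ; b₃ = b₃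
  ; balance = balance (suc h) n
  ; small   = λ y → fits-modulus ∘ y<end y
  ; fill    = λ y v<2y 2y≤V w∤y → fill y (above v<2y) (below 2y≤V) w∤y
  }
  where
  open Range n κ 0 2 z≤n k≡ (+-comm k 4)
  b₀ b₁ b₂ b₃ : ℕ
  b₀ = suc h
  b₂ = b₀ + n
  b₃ = suc (b₂ + n)
  b₁ = b₃ + n
  balance : ∀ s n → s + (suc (s + n + n) + n) ≡ (s + n) + suc (s + n + n)
  balance = ℕSolver.solve-∀
  gap : b₂ + n ≡ suc κ * w
  gap = ring κ n
    where
    ring : ∀ κ n → suc (κ * (1 + 2 * n) + 0 * n) + n + n ≡ (1 + κ) * (1 + 2 * n)
    ring = ℕSolver.solve-∀
  end : b₁ + n ≡ h + 2 * w
  end = ring h n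
    where
    ring : ∀ h n → suc (suc h + n + n) + n + n ≡ h + 2 * (1 + 2 * n)
    ring = ℕSolver.solve-∀
  end′ : b₁ + n ≡ (2 + κ) * w
  end′ = trans end (ring κ n)
    where
    ring : ∀ κ n → (κ * (1 + 2 * n) + 0 * n) + 2 * (1 + 2 * n) ≡ (2 + κ) * (1 + 2 * n)
    ring = ℕSolver.solve-∀
  b₃+n≤ : b₃ + n ≤ h + 2 * w + 0
  b₃+n≤ = ≤-trans (m≤m+n b₁ n) (≤-reflexive (trans end (sym (+-identityʳ _))))
  b₂+n≤ : b₂ + n ≤ h + 2 * w + 0
  b₂+n≤ = ≤-trans (≤-trans (n≤1+n _) (m≤m+n b₃ n)) b₃+n≤
  y<end : ∀ y → (y ∈[ b₀ ,+ n ⟩ ⊎ y ∈[ b₁ ,+ n ⟩) ⊎ (y ∈[ b₂ ,+ n ⟩ ⊎ y ∈[ b₃ ,+ n ⟩) → y < h + 2 * w + 0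
  y<end y (inj₁ (inj₁ (_ , y<))) = <-≤-trans y< (≤-trans (m≤m+n b₂ n) b₂+n≤)
  y<end y (inj₁ (inj₂ (_ , y<))) = <-≤-trans y< (≤-reflexive (trans end (sym (+-identityʳ _))))
  y<end y (inj₂ (inj₁ (_ , y<))) = <-≤-trans y< b₂+n≤
  y<end y (inj₂ (inj₂ (_ , y<))) = <-≤-trans y< b₃+n≤
  fill : ∀ y → suc h ≤ y → y < suc (h + 2 * w) → ¬ w ∣ y → (y ∈[ b₀ ,+ n ⟩ ⊎ y ∈[ b₁ ,+ n ⟩) ⊎ (y ∈[ b₂ ,+ n ⟩ ⊎ y ∈[ b₃ ,+ n ⟩)
  fill y ≤y y< w∤y with cut n ≤y
  ... | inj₁ y∈ = inj₁ (inj₁ y∈)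
  ... | inj₂ ≤y with cut n ≤y
  ...   | inj₁ y∈ = inj₂ (inj₁ y∈)
  ...   | inj₂ ≤y with cut n (skip (suc κ) w∤y gap ≤y)
  ...     | inj₁ y∈ = inj₂ (inj₂ y∈)
  ...     | inj₂ ≤y with cut n ≤y
  ...       | inj₁ y∈ = inj₁ (inj₂ y∈)
  ...       | inj₂ ≤y = contradiction (skip (2 + κ) w∤y end′ ≤y) (<⇒≱ (subst (λ z → y < suc z) (sym end) y<))

-- Here h = κ w + n lies in the middle of a run, so the range is a half run, a full run and a half
-- run, separated by (κ + 1) w and (κ + 2) w. The full run splits into b₂ and b₃; b₀ and b₁ are the
-- half runs.
fourIntervals-odd : ∀ n κ {k} → k ≡ 1 + 2 * κ → FourIntervals n k
fourIntervals-odd n κ {k} k≡ = record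
  { b₀ = b₀ ; b₁ = b₁ ; b₂ = b₂ ; b₃ = b₃
  ; balance = balance (suc h) n
  ; small   = λ y → fits-modulus ∘ y<end y
  ; fill    = λ y v<2y 2y≤V w∤y → fill y (above v<2y) (below 2y≤V) w∤y
  }
  where
  open Range n κ 1 2 ≤-refl k≡ (+-comm k 4)
  b₀ b₁ b₂ b₃ : ℕ
  b₀ = suc h
  b₂ = suc (b₀ + n)
  b₃ = b₂ + n
  b₁ = suc (b₃ + n)
  balance : ∀ s n → s + suc (suc (s + n) + n + n) ≡ suc (s + n) + (suc (s + n) + n)
  balance = ℕSolver.solve-∀
  gap₁ : b₀ + n ≡ suc κ * w
  gap₁ = ring κ n
    where
    ring : ∀ κ n → suc (κ * (1 + 2 * n) + 1 * n) + n ≡ (1 + κ) * (1 + 2 * n)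
    ring = ℕSolver.solve-∀
  gap₂ : b₃ + n ≡ (2 + κ) * w
  gap₂ = ring κ n
    where
    ring : ∀ κ n → suc (suc (κ * (1 + 2 * n) + 1 * n) + n) + n + n ≡ (2 + κ) * (1 + 2 * n)
    ring = ℕSolver.solve-∀
  end : b₁ + n ≡ h + 2 * w + 1
  end = ring h n
    where
    ring : ∀ h n → suc (suc (suc h + n) + n + n) + n ≡ h + 2 * (1 + 2 * n) + 1
    ring = ℕSolver.solve-∀
  b₃+n≤ : b₃ + n ≤ h + 2 * w + 1
  b₃+n≤ = ≤-trans (≤-trans (n≤1+n _) (m≤m+n b₁ n)) (≤-reflexive end)
  b₂+n≤ : b₂ + n ≤ h + 2 * w + 1
  b₂+n≤ = ≤-trans (m≤m+n b₃ n) b₃+n≤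
  y<end : ∀ y → (y ∈[ b₀ ,+ n ⟩ ⊎ y ∈[ b₁ ,+ n ⟩) ⊎ (y ∈[ b₂ ,+ n ⟩ ⊎ y ∈[ b₃ ,+ n ⟩) → y < h + 2 * w + 1
  y<end y (inj₁ (inj₁ (_ , y<))) = <-≤-trans y< (≤-trans (≤-trans (n≤1+n _) (m≤m+n b₂ n)) b₂+n≤)
  y<end y (inj₁ (inj₂ (_ , y<))) = <-≤-trans y< (≤-reflexive end)
  y<end y (inj₂ (inj₁ (_ , y<))) = <-≤-trans y< b₂+n≤
  y<end y (inj₂ (inj₂ (_ , y<))) = <-≤-trans y< b₃+n≤
  fill : ∀ y → suc h ≤ y → y < suc (h + 2 * w) → ¬ w ∣ y → (y ∈[ b₀ ,+ n ⟩ ⊎ y ∈[ b₁ ,+ n ⟩) ⊎ (y ∈[ b₂ ,+ n ⟩ ⊎ y ∈[ b₃ ,+ n ⟩)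
  fill y ≤y y< w∤y with cut n ≤y
  ... | inj₁ y∈ = inj₁ (inj₁ y∈)
  ... | inj₂ ≤y with cut n (skip (suc κ) w∤y gap₁ ≤y)
  ...   | inj₁ y∈ = inj₂ (inj₁ y∈)
  ...   | inj₂ ≤y with cut n ≤y
  ...     | inj₁ y∈ = inj₂ (inj₂ y∈)
  ...     | inj₂ ≤y with cut n (skip (2 + κ) w∤y gap₂ ≤y)
  ...       | inj₁ y∈ = inj₁ (inj₂ y∈)
  ...       | inj₂ ≤y = contradiction ≤y (<⇒≱ (subst (y <_) (sym (trans end (+-comm (h + 2 * w) 1))) y<))

fourIntervals : ∀ n k → FourIntervals n k
fourIntervals n k with halve k
... | κ , inj₁ k≡ = fourIntervals-even n κ k≡
... | κ , inj₂ k≡ = fourIntervals-odd n κ k≡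

-- Block diagonals filled from runs of consecutive numbers

position : ∀ {N} (J : Fin N) a b c → c + toℕ (combine J (combine a b)) ≡ c + 4 * toℕ J + 1 * toℕ (combine {2} {2} a b)
position J a b c = begin
  c + toℕ (combine J (combine a b))              ≡⟨ cong (c +_) (Fin.toℕ-combine J (combine a b)) ⟩
  c + (4 * toℕ J + toℕ (combine a b))            ≡⟨ +-assoc c (4 * toℕ J) _ ⟨
  c + 4 * toℕ J + toℕ (combine a b)              ≡⟨ cong (c + 4 * toℕ J +_) (+-identityʳ _) ⟨
  c + 4 * toℕ J + 1 * toℕ (combine a b)          ∎
  where open ≡-Reasoning

-- The digits of y - c in mixed radix N, 2, 2 name the block and the cell. The factor `1 *` is the
-- gap, kept so that the right-hand side is definitionally a `size`.
locate : ∀ N c {y} → y ∈[ c ,+ N * 4 ⟩ → ∃[ J ] ∃[ a ] ∃[ b ] y ≡ c + 4 * toℕ {N} J + 1 * toℕ (combine {2} {2} a b)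
locate N c y∈ with offset y∈
... | x , y≡ with Fin.combine-surjective {N} {4} x
...   | J , p , refl with Fin.combine-surjective {2} {2} p
...     | a , b , refl = J , a , b , trans y≡ (position J a b c)

position< : ∀ {N} (J : Fin N) a b c → c + 4 * toℕ J + 1 * toℕ (combine {2} {2} a b) < c + N * 4
position< {N} J a b c = subst (_< c + N * 4) (position J a b c) (+-monoʳ-< c (Fin.toℕ<n (combine J (combine a b))))

module _ {N : ℕ} (base : Fin 2 → Fin N → ℕ) where

  blocks₂ : Blocks 2 N
  blocks₂ = record
    { sgn  = λ { 0F → Sign.+ ; 1F → Sign.- }
    ; gap  = λ _ → 1
    ; base = base
    }
  open Blocks blocks₂ using (entry)

  -- For a concrete `a` the list computes to the expression in `ring`. The upper row of a positive
  -- block sums to -1 and the lower to 1, whatever the base, and the negative block contributes the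
  -- opposite.
  rowSum₂ : ∀ (Js : Fin 2 → Fin N) a →
    sumℤ (tabulate {n = 4} λ x → let (u , s) = remQuot {2} 2 x in entry u (Js u) a (flip s a)) ≡ 0ℤ
  rowSum₂ Js 0F = ring (ℤ.+ base 0F (Js 0F)) (ℤ.+ base 1F (Js 1F))
    where
    ring : ∀ x y → (x ℤ.+ ℤ.+ 0) ℤ.+ ((ℤ.- (x ℤ.+ ℤ.+ 1)) ℤ.+ ((ℤ.- (y ℤ.+ ℤ.+ 0)) ℤ.+ ((y ℤ.+ ℤ.+ 1) ℤ.+ ℤ.+ 0))) ≡ ℤ.+ 0
    ring = ℤSolver.solve-∀
  rowSum₂ Js 1F = ring (ℤ.+ base 0F (Js 0F)) (ℤ.+ base 1F (Js 1F))
    where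
    ring : ∀ x y → (x ℤ.+ ℤ.+ 3) ℤ.+ ((ℤ.- (x ℤ.+ ℤ.+ 2)) ℤ.+ ((ℤ.- (y ℤ.+ ℤ.+ 3)) ℤ.+ ((y ℤ.+ ℤ.+ 2) ℤ.+ ℤ.+ 0))) ≡ ℤ.+ 0
    ring = ℤSolver.solve-∀

  colSum₂ : ∀ J b → sumℤ (tabulate {n = 4} λ x → let (u , s) = remQuot {2} 2 x in entry u J (flip s b) b) ≡ 0ℤ
  colSum₂ J 0F = ring (ℤ.+ base 0F J) (ℤ.+ base 1F J)
    where
    ring : ∀ x y → (x ℤ.+ ℤ.+ 0) ℤ.+ ((ℤ.- (x ℤ.+ ℤ.+ 2)) ℤ.+ ((ℤ.- (y ℤ.+ ℤ.+ 0)) ℤ.+ ((y ℤ.+ ℤ.+ 2) ℤ.+ ℤ.+ 0))) ≡ ℤ.+ 0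
    ring = ℤSolver.solve-∀
  colSum₂ J 1F = ring (ℤ.+ base 0F J) (ℤ.+ base 1F J)
    where
    ring : ∀ x y → (x ℤ.+ ℤ.+ 3) ℤ.+ ((ℤ.- (x ℤ.+ ℤ.+ 1)) ℤ.+ ((ℤ.- (y ℤ.+ ℤ.+ 3)) ℤ.+ ((y ℤ.+ ℤ.+ 1) ℤ.+ ℤ.+ 0))) ≡ ℤ.+ 0
    ring = ℤSolver.solve-∀

module _ {N : ℕ} (base : Fin 3 → Fin N → ℕ) where

  blocks₃ : Blocks 3 N
  blocks₃ = record
    { sgn  = λ { 0F → Sign.+ ; 1F → Sign.+ ; 2F → Sign.- }
    ; gap  = λ { 0F → 1 ; 1F → 1 ; 2F → 2 }
    ; base = base
    }
  open Blocks blocks₃ using (entry)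

  rowSum₃ : ∀ (Js : Fin 3 → Fin N) a →
    sumℤ (tabulate {n = 6} λ x → let (u , s) = remQuot {3} 2 x in entry u (Js u) a (flip s a)) ≡ 0ℤ
  rowSum₃ Js 0F = ring (ℤ.+ base 0F (Js 0F)) (ℤ.+ base 1F (Js 1F)) (ℤ.+ base 2F (Js 2F))
    where
    ring : ∀ x y z → (x ℤ.+ ℤ.+ 0) ℤ.+ ((ℤ.- (x ℤ.+ ℤ.+ 1)) ℤ.+ ((y ℤ.+ ℤ.+ 0) ℤ.+ ((ℤ.- (y ℤ.+ ℤ.+ 1)) ℤ.+
      ((ℤ.- (z ℤ.+ ℤ.+ 0)) ℤ.+ ((z ℤ.+ ℤ.+ 2) ℤ.+ ℤ.+ 0))))) ≡ ℤ.+ 0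
    ring = ℤSolver.solve-∀
  rowSum₃ Js 1F = ring (ℤ.+ base 0F (Js 0F)) (ℤ.+ base 1F (Js 1F)) (ℤ.+ base 2F (Js 2F))
    where
    ring : ∀ x y z → (x ℤ.+ ℤ.+ 3) ℤ.+ ((ℤ.- (x ℤ.+ ℤ.+ 2)) ℤ.+ ((y ℤ.+ ℤ.+ 3) ℤ.+ ((ℤ.- (y ℤ.+ ℤ.+ 2)) ℤ.+
      ((ℤ.- (z ℤ.+ ℤ.+ 6)) ℤ.+ ((z ℤ.+ ℤ.+ 4) ℤ.+ ℤ.+ 0))))) ≡ ℤ.+ 0
    ring = ℤSolver.solve-∀

  colSum₃ : ∀ J b → sumℤ (tabulate {n = 6} λ x → let (u , s) = remQuot {3} 2 x in entry u J (flip s b) b) ≡ 0ℤ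
  colSum₃ J 0F = ring (ℤ.+ base 0F J) (ℤ.+ base 1F J) (ℤ.+ base 2F J)
    where
    ring : ∀ x y z → (x ℤ.+ ℤ.+ 0) ℤ.+ ((ℤ.- (x ℤ.+ ℤ.+ 2)) ℤ.+ ((y ℤ.+ ℤ.+ 0) ℤ.+ ((ℤ.- (y ℤ.+ ℤ.+ 2)) ℤ.+
      ((ℤ.- (z ℤ.+ ℤ.+ 0)) ℤ.+ ((z ℤ.+ ℤ.+ 4) ℤ.+ ℤ.+ 0))))) ≡ ℤ.+ 0
    ring = ℤSolver.solve-∀
  colSum₃ J 1F = ring (ℤ.+ base 0F J) (ℤ.+ base 1F J) (ℤ.+ base 2F J)
    where
    ring : ∀ x y z → (x ℤ.+ ℤ.+ 3) ℤ.+ ((ℤ.- (x ℤ.+ ℤ.+ 1)) ℤ.+ ((y ℤ.+ ℤ.+ 3) ℤ.+ ((ℤ.- (y ℤ.+ ℤ.+ 1)) ℤ.+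
      ((ℤ.- (z ℤ.+ ℤ.+ 6)) ℤ.+ ((z ℤ.+ ℤ.+ 2) ℤ.+ ℤ.+ 0))))) ≡ ℤ.+ 0
    ring = ℤSolver.solve-∀

-- For even k the range is two full runs of 2n = 4N numbers, and a run is exactly N blocks of four
-- consecutive numbers: one block diagonal per run.
module TwoBlockDiagonals (N κ : ℕ) {k k′ : ℕ} (k≡ : k ≡ 0 + 2 * κ) (k′≡ : k′ ≡ 4 + k) where
  open Range (N * 2) κ 0 2 z≤n k≡ k′≡

  c₀ c₁ : ℕ
  c₀ = suc h
  c₁ = suc (c₀ + N * 4)

  gap-multiple : c₀ + N * 4 ≡ suc κ * w
  gap-multiple = ring κ N
    where
    ring : ∀ κ N → suc (κ * (1 + 2 * (N * 2)) + 0 * (N * 2)) + N * 4 ≡ (1 + κ) * (1 + 2 * (N * 2))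
    ring = ℕSolver.solve-∀

  end : c₁ + N * 4 ≡ h + 2 * w
  end = ring h N
    where
    ring : ∀ h N → suc (suc h + N * 4) + N * 4 ≡ h + 2 * (1 + 2 * (N * 2))
    ring = ℕSolver.solve-∀

  end-multiple : c₁ + N * 4 ≡ (2 + κ) * w
  end-multiple = trans end (ring κ N)
    where
    ring : ∀ κ N → (κ * (1 + 2 * (N * 2)) + 0 * (N * 2)) + 2 * (1 + 2 * (N * 2)) ≡ (2 + κ) * (1 + 2 * (N * 2))
    ring = ℕSolver.solve-∀

  base : Fin 2 → Fin N → ℕ
  base 0F J = c₀ + 4 * toℕ J
  base 1F J = c₁ + 4 * toℕ J

  open Blocks (blocks₂ base) using (size)

  size< : ∀ u J a b → size u J a b < h + 2 * w + 0
  size< 0F J a b = <-≤-trans (position< J a b c₀) (≤-trans (n≤1+n _) (≤-trans (m≤m+n c₁ (N * 4)) (≤-reflexive (trans end (sym (+-identityʳ _))))))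
  size< 1F J a b = <-≤-trans (position< J a b c₁) (≤-reflexive (trans end (sym (+-identityʳ _))))

  fill : ∀ y → suc h ≤ y → y < suc (h + 2 * w) → ¬ w ∣ y → ∃[ u ] ∃[ J ] ∃[ a ] ∃[ b ] y ≡ size u J a b
  fill y ≤y y< w∤y with cut (N * 4) ≤y
  ... | inj₁ y∈ = 0F , locate N c₀ y∈
  ... | inj₂ ≤y with cut (N * 4) (skip (suc κ) w∤y gap-multiple ≤y)
  ...   | inj₁ y∈ = 1F , locate N c₁ y∈
  ...   | inj₂ ≤y = contradiction (skip (2 + κ) w∤y end-multiple ≤y) (<⇒≱ (subst (λ z → y < suc z) (sym end) y<))

  bases : BlockFilling 2 N k k′
  bases = record
    { blocks = blocks₂ base
    ; enough = k′≡
    ; rowSum = rowSum₂ base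
    ; colSum = colSum₂ base
    ; small  = λ u J a b → fits-modulus (size< u J a b)
    ; fill   = λ y v<2y 2y≤V w∤y → fill y (above v<2y) (below 2y≤V) w∤y
    }

-- For odd k the range starts and ends in mid-run, so with n = 4q its runs have lengths 4q, 8q, 8q,
-- 4q. The two short runs share one block diagonal, the first long run makes the other with gap 1,
-- and the second long run makes the one with gap 2.
module ThreeBlockDiagonals (q κ : ℕ) {k k′ : ℕ} (k≡ : k ≡ 1 + 2 * κ) (k′≡ : k′ ≡ 6 + k) where
  open Range (q * 2 * 2) κ 1 3 ≤-refl k≡ k′≡

  c₀ c₁ c₂ c₃ : ℕ
  c₀ = suc h
  c₁ = suc (c₀ + q * 4)
  c₂ = suc (c₁ + q * 2 * 4)
  c₃ = suc (c₂ + q * 8)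

  gap₁ : c₀ + q * 4 ≡ suc κ * w
  gap₁ = ring κ q
    where
    ring : ∀ κ q → suc (κ * (1 + 2 * (q * 2 * 2)) + 1 * (q * 2 * 2)) + q * 4 ≡ (1 + κ) * (1 + 2 * (q * 2 * 2))
    ring = ℕSolver.solve-∀

  gap₂ : c₁ + q * 2 * 4 ≡ (2 + κ) * w
  gap₂ = trans (cong (λ z → suc z + q * 2 * 4) gap₁) (ring κ q)
    where
    ring : ∀ κ q → suc ((1 + κ) * (1 + 2 * (q * 2 * 2))) + q * 2 * 4 ≡ (2 + κ) * (1 + 2 * (q * 2 * 2))
    ring = ℕSolver.solve-∀

  gap₃ : c₂ + q * 8 ≡ (3 + κ) * w
  gap₃ = trans (cong (λ z → suc z + q * 8) gap₂) (ring κ q)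
    where
    ring : ∀ κ q → suc ((2 + κ) * (1 + 2 * (q * 2 * 2))) + q * 8 ≡ (3 + κ) * (1 + 2 * (q * 2 * 2))
    ring = ℕSolver.solve-∀

  end : c₃ + q * 4 ≡ h + 3 * w + 1
  end = ring h q
    where
    ring : ∀ h q → suc (suc (suc (suc h + q * 4) + q * 2 * 4) + q * 8) + q * 4 ≡ h + 3 * (1 + 2 * (q * 2 * 2)) + 1
    ring = ℕSolver.solve-∀

  -- Each short run holds only q blocks, half of a block diagonal. Writing the block column as 2g +
  -- p, the digit p chooses the run.
  spread : Fin q → Fin 2 → ℕ
  spread g 0F = c₀ + 4 * toℕ g
  spread g 1F = c₃ + 4 * toℕ g

  -- The blocks of the third diagonal are interlaced in pairs: x, x + 2, x + 4, x + 6 with x + 1, x + 3, x + 5, x + 7.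
  interlaced : Fin q → Fin 2 → ℕ
  interlaced g p = c₂ + 8 * toℕ g + toℕ p

  base : Fin 3 → Fin (q * 2) → ℕ
  base 0F J = c₁ + 4 * toℕ J
  base 1F J = uncurry spread (remQuot 2 J)
  base 2F J = uncurry interlaced (remQuot 2 J)

  open Blocks (blocks₃ base) using (size)

  -- Interlacing moves p to the last binary digit: the cell at 2a + b takes the number 8g + 2(2a +
  -- b) + p of the run, which makes the gap 2.
  interlaced-position : ∀ g p a b →
    c₂ + toℕ (combine g (combine (combine {2} {2} a b) p)) ≡ interlaced g p + 2 * toℕ (combine {2} {2} a b)
  interlaced-position g p a b = begin
    c₂ + toℕ (combine g (combine (combine a b) p))           ≡⟨ cong (c₂ +_) (Fin.toℕ-combine g (combine (combine a b) p)) ⟩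
    c₂ + (8 * toℕ g + toℕ (combine (combine a b) p))         ≡⟨ cong (λ z → c₂ + (8 * toℕ g + z)) (Fin.toℕ-combine (combine a b) p) ⟩
    c₂ + (8 * toℕ g + (2 * toℕ (combine a b) + toℕ p))       ≡⟨ ring c₂ (toℕ g) (toℕ (combine a b)) (toℕ p) ⟩
    interlaced g p + 2 * toℕ (combine a b)                   ∎
    where
    open ≡-Reasoning
    ring : ∀ c g t p → c + (8 * g + (2 * t + p)) ≡ c + 8 * g + p + 2 * t
    ring = ℕSolver.solve-∀

  size-1 : ∀ g p a b → size 1F (combine g p) a b ≡ spread g p + 1 * toℕ (combine a b)
  size-1 g p a b = cong (λ gp → uncurry spread gp + 1 * toℕ (combine a b)) (Fin.remQuot-combine g p)

  size-2 : ∀ g p a b → size 2F (combine g p) a b ≡ interlaced g p + 2 * toℕ (combine a b)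
  size-2 g p a b = cong (λ gp → uncurry interlaced gp + 2 * toℕ (combine a b)) (Fin.remQuot-combine g p)

  c₃≤end : c₃ ≤ h + 3 * w + 1
  c₃≤end = ≤-trans (m≤m+n c₃ (q * 4)) (≤-reflexive end)

  c₂≤end : c₂ ≤ h + 3 * w + 1
  c₂≤end = ≤-trans (≤-trans (m≤m+n c₂ (q * 8)) (n≤1+n _)) c₃≤end

  c₁≤end : c₁ ≤ h + 3 * w + 1
  c₁≤end = ≤-trans (≤-trans (m≤m+n c₁ (q * 2 * 4)) (n≤1+n _)) c₂≤end

  size< : ∀ u J a b → size u J a b < h + 3 * w + 1
  size< 0F J a b = <-≤-trans (position< J a b c₁) (≤-trans (n≤1+n _) c₂≤end)
  size< 1F J a b with Fin.combine-surjective {q} {2} J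
  ... | g , 0F , refl = subst (_< h + 3 * w + 1) (sym (size-1 g 0F a b)) (<-≤-trans (position< g a b c₀) (≤-trans (n≤1+n _) c₁≤end))
  ... | g , 1F , refl = subst (_< h + 3 * w + 1) (sym (size-1 g 1F a b)) (<-≤-trans (position< g a b c₃) (≤-reflexive end))
  size< 2F J a b with Fin.combine-surjective {q} {2} J
  ... | g , p , refl = subst (_< h + 3 * w + 1) (sym (trans (size-2 g p a b) (sym (interlaced-position g p a b))))
    (<-≤-trans (+-monoʳ-< c₂ (Fin.toℕ<n (combine g (combine (combine a b) p)))) (≤-trans (n≤1+n _) c₃≤end))

  locate-interlaced : ∀ {y} → y ∈[ c₂ ,+ q * 8 ⟩ → ∃[ J ] ∃[ a ] ∃[ b ] y ≡ size 2F J a b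
  locate-interlaced y∈ with offset y∈
  ... | x , y≡ with Fin.combine-surjective {q} {8} x
  ...   | g , e , refl with Fin.combine-surjective {4} {2} e
  ...     | t , p , refl with Fin.combine-surjective {2} {2} t
  ...       | a , b , refl = combine g p , a , b , trans y≡ (trans (interlaced-position g p a b) (sym (size-2 g p a b)))

  Located : ℕ → Set
  Located y = ∃[ u ] ∃[ J ] ∃[ a ] ∃[ b ] y ≡ size u J a b

  locate-low : ∀ {y} → y ∈[ c₀ ,+ q * 4 ⟩ → Located y
  locate-low y∈ = let (g , a , b , y≡) = locate q c₀ y∈ in 1F , combine g 0F , a , b , trans y≡ (sym (size-1 g 0F a b))

  locate-high : ∀ {y} → y ∈[ c₃ ,+ q * 4 ⟩ → Located y
  locate-high y∈ = let (g , a , b , y≡) = locate q c₃ y∈ in 1F , combine g 1F , a , b , trans y≡ (sym (size-1 g 1F a b))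

  fill : ∀ y → suc h ≤ y → y < suc (h + 3 * w) → ¬ w ∣ y → Located y
  fill y c₀≤y y< w∤y = Sum.[ locate-low , from-gap₁ ]′ (cut (q * 4) c₀≤y)
    where
    from-gap₃ : c₂ + q * 8 ≤ y → Located y
    from-gap₃ ≤y = Sum.[ locate-high , (λ end≤y → contradiction end≤y (<⇒≱ (subst (y <_) (sym (trans end (+-comm (h + 3 * w) 1))) y<))) ]′
      (cut (q * 4) (skip (3 + κ) w∤y gap₃ ≤y))
    from-gap₂ : c₁ + q * 2 * 4 ≤ y → Located y
    from-gap₂ ≤y = Sum.[ (λ y∈ → 2F , locate-interlaced y∈) , from-gap₃ ]′ (cut (q * 8) (skip (2 + κ) w∤y gap₂ ≤y))
    from-gap₁ : c₀ + q * 4 ≤ y → Located y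
    from-gap₁ ≤y = Sum.[ (λ y∈ → 0F , locate (q * 2) c₁ y∈) , from-gap₂ ]′ (cut (q * 2 * 4) (skip (suc κ) w∤y gap₁ ≤y))

  bases : BlockFilling 3 (q * 2) k k′
  bases = record
    { blocks = blocks₃ base
    ; enough = k′≡
    ; rowSum = rowSum₃ base
    ; colSum = colSum₃ base
    ; small  = λ u J a b → fits-modulus (size< u J a b)
    ; fill   = λ y v<2y 2y≤V w∤y → fill y (above v<2y) (below 2y≤V) w∤y
    }

-- Assembling the three extensions

extend-diagonal : ∀ n k .{{_ : NonZero n}} .{{_ : NonZero k}} → n ≥ k + 4 →
  (∃[ A ] (IsIntegerHeffter n k k A × CyclicallyDiagonal k A)) →
  ∃[ A ] (IsIntegerHeffter n (k + 4) (k + 4) A × CyclicallyDiagonal (k + 4) A)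
extend-diagonal n k n≥k+4 (A , isInteger , diagonal) = AddDiagonals.extension (fourIntervals n k) isInteger diagonal n≥k+4

-- Reads the lower bound on n in units of blocks: there is room for m further block diagonals.
halve-≤ : ∀ {d m N} → 2 * d + 2 * m ≤ N * 2 → d + m ≤ N
halve-≤ {d} {m} {N} le = *-cancelˡ-≤ 2 (subst₂ _≤_ (sym (*-distribˡ-+ 2 d m)) (*-comm N 2) le)

extend-blocks-even : ∀ n d .{{_ : NonZero n}} .{{_ : NonZero d}} → n ≥ 2 * d + 4 →
  (∃[ S ] (IsIntegerHeffter n (2 * d) (2 * d) S × CyclicallyBlockDiagonal 2 d S)) →
  ∃[ S ] (IsIntegerHeffter n (2 * d + 4) (2 * d + 4) S × CyclicallyBlockDiagonal 2 (d + 2) S)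
extend-blocks-even n d n≥ (S , isInteger , record { N = N ; A = A ; A-diagonal = diagonal ; B = B ; B-empty = B-empty ; size = refl ; shift = shift ; columns = columns }) =
  AddBlockDiagonals.extension {m = 2} {d = d} {{N*2≢0}} {{m*n≢0 2 d}} (m<m+n (2 * d) (z<s {3})) (TwoBlockDiagonals.bases N d refl (+-comm (2 * d) 4))
    isInteger A diagonal B B-empty shift columns (halve-≤ {d} n≥)
  where
  N*2≢0 : NonZero (N * 2)
  N*2≢0 = >-nonZero (≤-trans (≤-trans z<s (m≤n+m 4 (2 * d))) n≥)

extend-blocks-odd : ∀ n d .{{_ : NonZero n}} .{{_ : NonZero d}} → n % 4 ≡ 0 → n ≥ 2 * d + 6 →
  (∃[ S ] (IsIntegerHeffter n (2 * d ∸ 1) (2 * d ∸ 1) S × CyclicallyBlockDiagonal 2 d S)) →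
  ∃[ S ] (IsIntegerHeffter n (2 * d + 5) (2 * d + 5) S × CyclicallyBlockDiagonal 2 (d + 3) S)
-- With `suc d` old block diagonals the truncated subtraction loses nothing, and k = 1 + 2 d puts κ
-- = d.
extend-blocks-odd n (suc d) n%4≡0 n≥ (S , isInteger , record { N = N ; A = A ; A-diagonal = diagonal ; B = B ; B-empty = B-empty ; size = refl ; shift = shift ; columns = columns }) =
  AddBlockDiagonals.extension {m = 3} {d = suc d} {{N*2≢0}} {{k≢0}} k<k′ (bases (m%n≡0⇒n∣m (N * 2) 4 n%4≡0))
    isInteger A diagonal B B-empty shift columns (halve-≤ {suc d} n≥)
  where
  k k′ : ℕ
  k = 2 * suc d ∸ 1
  k′ = 2 * suc d + 5
  k≡ : k ≡ 1 + 2 * d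
  k≡ = ring d
    where
    ring : ∀ d → d + suc (d + 0) ≡ 1 + 2 * d
    ring = ℕSolver.solve-∀
  k′≡ : k′ ≡ 6 + k
  k′≡ = ring d
    where
    ring : ∀ d → 2 * suc d + 5 ≡ 6 + (d + suc (d + 0))
    ring = ℕSolver.solve-∀
  bases : 4 ∣ N * 2 → BlockFilling 3 N k k′
  -- From 2N = 4q follows N = 2q, so block columns can be paired.
  bases (divides q eq) = subst (λ N → BlockFilling 3 N k k′)
    (sym (*-cancelʳ-≡ N (q * 2) 2 (trans eq (sym (*-assoc q 2 2))))) (ThreeBlockDiagonals.bases q d k≡ k′≡)
  N*2≢0 : NonZero (N * 2)
  N*2≢0 = >-nonZero (≤-trans (≤-trans z<s (m≤n+m 6 (2 * suc d))) n≥)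
  k≢0 : NonZero k
  k≢0 = >-nonZero (subst (0 <_) (sym k≡) z<s)
  k<k′ : k < k′
  k<k′ = subst (k <_) (sym k′≡) (m<n+m k (z<s {5}))

theorem4p17 : (n k d : ℕ) .{{_ : NonZero n}} .{{_ : NonZero k}} .{{_ : NonZero d}} →
    ( (∃[ A ] (IsIntegerHeffter n k k A × CyclicallyDiagonal k A)) →
    n ≥ k + 4 →
    (∃[ A ] (IsIntegerHeffter n (k + 4) (k + 4) A × CyclicallyDiagonal (k + 4) A)) )
    ×
    ( (∃[ A ] (IsIntegerHeffter n (2 * d) (2 * d) A × CyclicallyBlockDiagonal 2 d A)) →
    n ≥ 2 * d + 4 →
    (∃[ A ] (IsIntegerHeffter n (2 * d + 4) (2 * d + 4) A × CyclicallyBlockDiagonal 2 (d + 2) A)) )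
    ×
    ( (∃[ A ] (IsIntegerHeffter n (2 * d ∸ 1) (2 * d ∸ 1) A × CyclicallyBlockDiagonal 2 d A)) →
    n % 4 ≡ 0 →
    n ≥ 2 * d + 6 →
    (∃[ A ] (IsIntegerHeffter n (2 * d + 5) (2 * d + 5) A × CyclicallyBlockDiagonal 2 (d + 3) A)) )
theorem4p17 n k d =
  (λ H n≥ → extend-diagonal n k n≥ H) , (λ H n≥ → extend-blocks-even n d n≥ H) , (λ H n%4≡0 n≥ → extend-blocks-odd n d n%4≡0 n≥ H)
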